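{- Fix an integer $r\ge 4$ and choose a real $$0<\delta<\frac1{2(r-1)}.$$ Then there is a constant $c=c(r,\delta)>0$ such that, for all sufficiently large $n$, the complete graph $K_n$ contains a subgraph $Y$ and a set $F\subseteq E(Y)$ such that $$\chi_{\mathrm f}(Y)\ge c\,\frac{n^\delta}{\log n},\qquad \Delta\bigl((V(Y),F)\bigr)\le 1,\qquad \operatorname{girth}(Y-F)\ge r.$$ Consequently $$h_r^{\mathrm f}(K_n)\ge c\,\frac{n^\delta}{\log n}.$$
   Context: All graphs are finite and simple; subgraphs need not be induced. $\chi_{\mathrm f}$ is the fractional chromatic number; $\Delta$ is the maximum degree; $(V(Y),F)$ is the graph on $V(Y)$ with edge set $F$; $Y-F$ is $Y$ with the edges of $F$ deleted. The girth of a forest is $\infty$; $\log$ is natural. $h_r^{\mathrm f}(G)=\max\{\chi_{\mathrm f}(H):H\subseteq G,\ \operatorname{girth}(H)\ge r\}$. The constant $c$ in the final bound may be taken smaller than the one in the first display, still depending only on $r,\delta$. -}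

module Defs where

open import Algebra.Definitions.RawSemiring using (_^_)
open import Data.Bool.Base using (Bool; true; false; T; _∧_; not; if_then_else_)
open import Data.Bool.Properties using (T?; T-∧)
open import Data.Empty using (⊥)
open import Data.Fin.Base using (Fin)
import Data.Fin.Properties as Fin
open import Data.Fin.Subset using (Subset; _∈_; _⊆_; ⁅_⁆; ∣_∣; inside; outside)
  renaming (⊤ to full; ⊥ to none)
open import Data.Fin.Subset.Properties using (_∈?_; _⊆?_; ∈⊤; ⊥⊆; x∈⁅x⁆; x∈⁅y⁆⇒x≡y)
open import Data.Integer.Base as ℤ using (ℤ; +_)
import Data.Integer.Properties as ℤ
open import Data.List.Base using (head; filter; map; upTo; allFin)
open import Data.List.Extrema.Nat using (max)
open import Data.List.Properties using (filter-none)
import Data.List.Relation.Unary.All as List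
open import Data.Nat.Base as ℕ using (ℕ; zero; suc; _∸_; _!; z≤n; s≤s)
import Data.Nat.Properties as ℕ
open import Data.Product using (∃; ∃-syntax; _×_; _,_; proj₁; proj₂)
open import Data.Rational.Base as ℚ
  using (ℚ; 0ℚ; 1ℚ; ½; _<_; _≤_; _+_; _*_; _-_; -_; _/_; 1/_; ↥_; ↧_; ↧ₙ_; positive; nonNegative)
import Data.Rational.Properties as ℚ
open import Data.Rational.Unnormalised.Base as ℚᵘ using (mkℚᵘ)
import Data.Rational.Unnormalised.Properties as ℚᵘ
open import Data.Vec.Base using (Vec; []; _∷_; _∷ʳ_; tabulate)
open import Data.Vec.Relation.Unary.AllPairs using (allPairs?)
open import Data.Vec.Relation.Unary.Linked using (Linked; _∷_; linked?)
open import Data.Vec.Relation.Unary.Unique.Propositional using (Unique)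
open import Function using (_∘_; _$_; Equivalence)
open import Relation.Binary.Construct.Add.Supremum.NonStrict ℕ._≤_ using (_≤⁺_; _≤⊤⁺)
open import Relation.Binary.Definitions using (tri<; tri≈; tri>)
open import Relation.Binary.PropositionalEquality
  using (_≡_; refl; sym; trans; cong; cong₂; subst; subst₂)
open import Relation.Nullary using (¬_; Dec; yes; no; does; contradiction)
open import Relation.Nullary.Construct.Add.Supremum using (_⁺; [_]; ⊤⁺)
open import Relation.Nullary.Decidable using (map′; ¬?; _×-dec_; _→-dec_)
open import Relation.Unary using (Decidable)

infixr 8 _^ℚ_
_^ℚ_ : ℚ → ℕ → ℚ
_^ℚ_ = _^_ ℚ.+-*-rawSemiring

-- Dedekind cuts, represented by their lower sets.  Locatedness, which is
-- classically automatic, is not required.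
record ℝ : Set₁ where
  field
    Lower     : ℚ → Set
    inhabited : ∃[ q ] Lower q
    bounded   : ∃[ q ] ¬ Lower q
    downward  : ∀ {p q} → p < q → Lower q → Lower p
    rounded   : ∀ {p} → Lower p → ∃[ q ] (p < q × Lower q)

  Lower<bound : ∀ {p q} → Lower p → ¬ Lower q → p < q
  Lower<bound {p} {q} p∈ q∉ with ℚ.<-cmp p q
  ... | tri< p<q _ _    = p<q
  ... | tri≈ _ refl _   = contradiction p∈ q∉
  ... | tri> _ _ q<p    = contradiction (downward q<p p∈) q∉

open ℝ public using (Lower)
open ℝ hiding (Lower)

infix 4 _≤ℝ_ _<ℝ_

_≤ℝ_ : ℝ → ℝ → Set
x ≤ℝ y = ∀ {q} → Lower x q → Lower y q

_<ℝ_ : ℝ → ℝ → Set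
x <ℝ y = ∃[ q ] (Lower y q × ¬ Lower x q)

q-1<q : ∀ q → q - 1ℚ < q
q-1<q q = subst (q - 1ℚ <_) (ℚ.+-identityʳ q) (ℚ.+-monoʳ-< q (ℚ.negative⁻¹ (- 1ℚ)))

fromℚ : ℚ → ℝ
fromℚ x = record
  { Lower     = _< x
  ; inhabited = x - 1ℚ , q-1<q x
  ; bounded   = x , ℚ.<-irrefl refl
  ; downward  = ℚ.<-trans
  ; rounded   = λ p<x → let m , p<m , m<x = ℚ.<-dense p<x in m , p<m , m<x
  }

fromℕ : ℕ → ℚ
fromℕ n = + n / 1

toℚᵘ-fromℕ : ∀ n → ℚ.toℚᵘ (fromℕ n) ℚᵘ.≃ mkℚᵘ (+ n) 0
toℚᵘ-fromℕ n = ℚ.toℚᵘ-fromℚᵘ (mkℚᵘ (+ n) 0)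

fromℕ-mono : ∀ {m n} → m ℕ.≤ n → fromℕ m ≤ fromℕ n
fromℕ-mono {m} {n} m≤n = ℚ.toℚᵘ-cancel-≤ $
  ℚᵘ.≤-respˡ-≃ (ℚᵘ.≃-sym (toℚᵘ-fromℕ m)) $
  ℚᵘ.≤-respʳ-≃ (ℚᵘ.≃-sym (toℚᵘ-fromℕ n)) $
  ℚᵘ.*≤* (ℤ.*-monoʳ-≤-nonNeg (+ 1) (ℤ.+≤+ m≤n))

fromℕ-* : ∀ m n → fromℕ (m ℕ.* n) ≡ fromℕ m * fromℕ n
fromℕ-* m n = ℚ.toℚᵘ-injective $
  ℚᵘ.≃-trans (toℚᵘ-fromℕ (m ℕ.* n)) $
  ℚᵘ.≃-trans (ℚᵘ.*≡* (cong (ℤ._* + 1) (ℤ.pos-* m n))) $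
  ℚᵘ.≃-trans (ℚᵘ.*-cong (ℚᵘ.≃-sym (toℚᵘ-fromℕ m)) (ℚᵘ.≃-sym (toℚᵘ-fromℕ n))) $
  ℚᵘ.≃-sym (ℚ.toℚᵘ-homo-* (fromℕ m) (fromℕ n))

fromℕ-^ : ∀ m k → fromℕ (m ℕ.^ k) ≡ fromℕ m ^ℚ k
fromℕ-^ m zero    = refl
fromℕ-^ m (suc k) = trans (fromℕ-* m (m ℕ.^ k)) (cong (fromℕ m *_) (fromℕ-^ m k))

0≤fromℕ : ∀ n → 0ℚ ≤ fromℕ n
0≤fromℕ n = fromℕ-mono {0} {n} z≤n

*-mono-≤ : ∀ {a b c d} → 0ℚ ≤ a → 0ℚ ≤ d → a ≤ b → c ≤ d → a * c ≤ b * d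
*-mono-≤ {a} {b} {c} {d} 0≤a 0≤d a≤b c≤d = ℚ.≤-trans
  (ℚ.*-monoˡ-≤-nonNeg a {{nonNegative 0≤a}} c≤d)
  (ℚ.*-monoʳ-≤-nonNeg d {{nonNegative 0≤d}} a≤b)

0≤*  : ∀ {a b} → 0ℚ ≤ a → 0ℚ ≤ b → 0ℚ ≤ a * b
0≤* 0≤a 0≤b = *-mono-≤ ℚ.≤-refl 0≤b 0≤a 0≤b

0<* : ∀ {a b} → 0ℚ < a → 0ℚ < b → 0ℚ < a * b
0<* {a} {b} 0<a 0<b =
  subst (_< a * b) (ℚ.*-zeroʳ a) (ℚ.*-monoʳ-<-pos a {{positive 0<a}} 0<b)

0<1 : 0ℚ < 1ℚ
0<1 = ℚ.positive⁻¹ 1ℚ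

0≤^ : ∀ {a} k → 0ℚ ≤ a → 0ℚ ≤ a ^ℚ k
0≤^ zero    0≤a = ℚ.<⇒≤ 0<1
0≤^ (suc k) 0≤a = 0≤* 0≤a (0≤^ k 0≤a)

^-mono-≤ : ∀ {a b} k → 0ℚ ≤ a → a ≤ b → a ^ℚ k ≤ b ^ℚ k
^-mono-≤ zero    0≤a a≤b = ℚ.≤-refl
^-mono-≤ (suc k) 0≤a a≤b =
  *-mono-≤ 0≤a (0≤^ k (ℚ.≤-trans 0≤a a≤b)) a≤b (^-mono-≤ k 0≤a a≤b)

0<^ : ∀ {a} k → 0ℚ < a → 0ℚ < a ^ℚ k
0<^ zero    0<a = 0<1
0<^ (suc k) 0<a = 0<* 0<a (0<^ k 0<a)

^-mono-< : ∀ {a b} k → 0ℚ ≤ a → a < b → a ^ℚ suc k < b ^ℚ suc k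
^-mono-< {a} {b} k 0≤a a<b = ℚ.≤-<-trans
  (ℚ.*-monoˡ-≤-nonNeg a {{nonNegative 0≤a}} (^-mono-≤ k 0≤a (ℚ.<⇒≤ a<b)))
  (ℚ.*-monoˡ-<-pos (b ^ℚ k) {{positive (0<^ k (ℚ.≤-<-trans 0≤a a<b))}} a<b)

record ℝ⁺ : Set₁ where
  field
    real : ℝ
    0<   : Lower real 0ℚ

open ℝ⁺ public using (real)
open ℝ⁺ using (0<)

infixl 7 _·_ _÷_
infix 8 _⁻¹

_·_ : ℝ⁺ → ℝ⁺ → ℝ⁺
x · y = record
  { real = record
    { Lower     = L
    ; inhabited = 0ℚ , 0∈
    ; bounded   = M * N , λ (a , b , 0<a , 0<b , a∈ , b∈ , MN<ab) →
        ℚ.<-irrefl refl $ ℚ.<-≤-trans MN<ab $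
          *-mono-≤ (ℚ.<⇒≤ 0<a) (ℚ.<⇒≤ (Lower<bound (real y) (0< y) N∉))
            (ℚ.<⇒≤ (Lower<bound (real x) a∈ M∉)) (ℚ.<⇒≤ (Lower<bound (real y) b∈ N∉))
    ; downward  = λ p<q (a , b , 0<a , 0<b , a∈ , b∈ , q<ab) →
        a , b , 0<a , 0<b , a∈ , b∈ , ℚ.<-trans p<q q<ab
    ; rounded   = λ (a , b , 0<a , 0<b , a∈ , b∈ , q<ab) →
        let m , q<m , m<ab = ℚ.<-dense q<ab
        in m , q<m , a , b , 0<a , 0<b , a∈ , b∈ , m<ab
    }
  ; 0< = 0∈
  }
  where
  L : ℚ → Set
  L q = ∃[ a ] ∃[ b ] (0ℚ < a × 0ℚ < b × Lower (real x) a × Lower (real y) b × q < a * b)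

  M = proj₁ (bounded (real x))
  N = proj₁ (bounded (real y))
  M∉ = proj₂ (bounded (real x))
  N∉ = proj₂ (bounded (real y))

  0∈ : L 0ℚ
  0∈ = let a , 0<a , a∈ = rounded (real x) (0< x)
           b , 0<b , b∈ = rounded (real y) (0< y)
       in a , b , 0<a , 0<b , a∈ , b∈ , 0<* 0<a 0<b

-- q < 1/x  iff  q r < 1 for some upper bound r of x.
_⁻¹ : ℝ⁺ → ℝ⁺
x ⁻¹ = record
  { real = record
    { Lower     = L
    ; inhabited = 0ℚ , 0∈
    ; bounded   = bnd
    ; downward  = λ p<q (r , r∉ , qr<1) →
        r , r∉ , ℚ.<-trans (ℚ.*-monoˡ-<-pos r {{positive (0<bound r∉)}} p<q) qr<1
    ; rounded   = rnd
    }
  ; 0< = 0∈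
  }
  where
  L : ℚ → Set
  L q = ∃[ r ] (¬ Lower (real x) r × q * r < 1ℚ)

  0<bound : ∀ {r} → ¬ Lower (real x) r → 0ℚ < r
  0<bound = Lower<bound (real x) (0< x)

  0∈ : L 0ℚ
  0∈ = let r , r∉ = bounded (real x) in r , r∉ , subst (_< 1ℚ) (sym (ℚ.*-zeroˡ r)) 0<1

  bnd : ∃[ q ] ¬ L q
  bnd with rounded (real x) (0< x)
  ... | a , 0<a , a∈ = 1/ a , λ (r , r∉ , r/a<1) → ℚ.<-asym r/a<1 $
      subst (_< 1/ a * r) (ℚ.*-inverseˡ a) $
      ℚ.*-monoʳ-<-pos (1/ a) {{ℚ.1/pos⇒pos a}} (Lower<bound (real x) a∈ r∉)
    where
    instance
      _ = positive 0<a
      _ = ℚ.pos⇒nonZero a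

  rnd : ∀ {q} → L q → ∃[ q′ ] (q < q′ × L q′)
  rnd {q} (r , r∉ , qr<1) =
    let m , q<m , m<1/r = ℚ.<-dense q<1/r
    in m , q<m , r , r∉ ,
       subst (m * r <_) (ℚ.*-inverseˡ r) (ℚ.*-monoˡ-<-pos r m<1/r)
    where
    instance
      _ = positive (0<bound r∉)
      _ = ℚ.pos⇒nonZero r
      _ = ℚ.1/pos⇒pos r

    q<1/r : q < 1/ r
    q<1/r = subst₂ _<_
      (trans (ℚ.*-assoc q r (1/ r)) (trans (cong (q *_) (ℚ.*-inverseʳ r)) (ℚ.*-identityʳ q)))
      (ℚ.*-identityˡ (1/ r))
      (ℚ.*-monoˡ-<-pos (1/ r) qr<1)

_÷_ : ℝ⁺ → ℝ⁺ → ℝ⁺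
x ÷ y = x · y ⁻¹

-- n ^ δ is the supremum of the rational powers n ^ (a / b) with 0 ≤ a / b < δ,
-- where s ≤ n ^ (a / b) is expressed as s ^ b ≤ n ^ a.
infixr 8 _^ℝ_

_^ℝ_ : (n : ℕ) → .{{ℕ.NonTrivial n}} → ℝ⁺ → ℝ⁺
n ^ℝ δ = record
  { real = record
    { Lower     = L
    ; inhabited = 0ℚ , 0∈
    ; bounded   = fromℕ (n ℕ.^ M) , bnd
    ; downward  = λ p<q (e , s , e∈ , 0≤e , 0≤s , s≤ , q<s) →
        e , s , e∈ , 0≤e , 0≤s , s≤ , ℚ.<-trans p<q q<s
    ; rounded   = λ (e , s , e∈ , 0≤e , 0≤s , s≤ , q<s) →
        let m , q<m , m<s = ℚ.<-dense q<s
        in m , q<m , e , s , e∈ , 0≤e , 0≤s , s≤ , m<s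
    }
  ; 0< = 0∈
  }
  where
  instance
    n≢0 : ℕ.NonZero n
    n≢0 = ℕ.nonTrivial⇒nonZero n

  L : ℚ → Set
  L q = ∃[ e ] ∃[ s ]
    (Lower (real δ) e × 0ℚ ≤ e × 0ℚ ≤ s × s ^ℚ (↧ₙ e) ≤ fromℕ (n ℕ.^ ℤ.∣ ↥ e ∣) × q < s)

  0∈ : L 0ℚ
  0∈ = 0ℚ , 1ℚ , 0< δ , ℚ.≤-refl , ℚ.<⇒≤ 0<1 , ℚ.≤-refl , 0<1

  u = proj₁ (bounded (real δ))
  M = ℤ.∣ ↥ u ∣

  exponent-bound : ∀ e → 0ℚ ≤ e → e < u → ℤ.∣ ↥ e ∣ ℕ.≤ M ℕ.* ↧ₙ e
  exponent-bound e 0≤e e<u = ℕ.≤-trans (ℕ.m≤m*n ℤ.∣ ↥ e ∣ (↧ₙ u)) (ℤ.drop‿+≤+ (subst₂ ℤ._≤_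
      (trans (cong (ℤ._* ↧ u) (sym (0≤⇒∣↥∣ e 0≤e))) (sym (ℤ.pos-* ℤ.∣ ↥ e ∣ (↧ₙ u))))
      (trans (cong (ℤ._* ↧ e) (sym (0≤⇒∣↥∣ u (ℚ.≤-trans 0≤e (ℚ.<⇒≤ e<u))))) (sym (ℤ.pos-* M (↧ₙ e))))
      (ℚ.drop-*≤* (ℚ.<⇒≤ e<u))))
    where
    0≤⇒∣↥∣ : ∀ e → 0ℚ ≤ e → + ℤ.∣ ↥ e ∣ ≡ ↥ e
    0≤⇒∣↥∣ e@record{} 0≤e = ℤ.0≤i⇒+∣i∣≡i (ℤ.nonNegative⁻¹ (↥ e) {{nonNegative 0≤e}})

  bnd : ¬ L (fromℕ (n ℕ.^ M))
  bnd (e , s , e∈ , 0≤e , 0≤s , s^b≤n^a , n^M<s) = ℚ.<-irrefl refl $ ℚ.<-≤-trans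
    (^-mono-< (ℚ.denominator-1 e) (0≤fromℕ (n ℕ.^ M)) n^M<s)
    (ℚ.≤-trans s^b≤n^a $ subst (fromℕ (n ℕ.^ ℤ.∣ ↥ e ∣) ≤_)
      (trans (cong fromℕ (sym (ℕ.^-*-assoc n M (↧ₙ e)))) (fromℕ-^ (n ℕ.^ M) (↧ₙ e)))
      (fromℕ-mono (ℕ.^-monoʳ-≤ n
        (exponent-bound e 0≤e (Lower<bound (real δ) e∈ (proj₂ (bounded (real δ))))))))

expTerm : ℚ → ℕ → ℚ
expTerm p i = p ^ℚ i * (+ 1 / (i !)) {{i ℕ.!≢0}}

expSum : ℚ → ℕ → ℚ
expSum p zero    = expTerm p zero
expSum p (suc k) = expSum p k + expTerm p (suc k)

-- The natural logarithm, as the supremum of the rationals p ≥ 0 with exp p ≤ n;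
-- for p ≥ 0, exp p is the supremum of the partial sums of the exponential series.
log : (n : ℕ) → .{{ℕ.NonTrivial n}} → ℝ⁺
log n = record
  { real = record
    { Lower     = L
    ; inhabited = 0ℚ , 0∈
    ; bounded   = fromℕ n , bnd
    ; downward  = λ p<q (s , 0≤s , s≤ , q<s) → s , 0≤s , s≤ , ℚ.<-trans p<q q<s
    ; rounded   = λ (s , 0≤s , s≤ , q<s) →
        let m , q<m , m<s = ℚ.<-dense q<s in m , q<m , s , 0≤s , s≤ , m<s
    }
  ; 0< = 0∈
  }
  where
  L : ℚ → Set
  L q = ∃[ p ] (0ℚ ≤ p × (∀ k → expSum p k ≤ fromℕ n) × q < p)

  0≤½ : 0ℚ ≤ ½
  0≤½ = ℚ.nonNegative⁻¹ ½

  1/suc≤1 : ∀ m .{{_ : ℕ.NonZero m}} → + 1 / m ≤ 1ℚ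
  1/suc≤1 m@(suc m-1) = ℚ.toℚᵘ-cancel-≤ $
    ℚᵘ.≤-respˡ-≃ (ℚᵘ.≃-sym (ℚ.toℚᵘ-fromℚᵘ (mkℚᵘ (+ 1) m-1))) $
    ℚᵘ.*≤* (ℤ.+≤+ (s≤s z≤n))

  term≤ : ∀ i → expTerm ½ i ≤ ½ ^ℚ i
  term≤ i = subst (expTerm ½ i ≤_) (ℚ.*-identityʳ (½ ^ℚ i)) $
    ℚ.*-monoˡ-≤-nonNeg (½ ^ℚ i) {{nonNegative (0≤^ i 0≤½)}} (1/suc≤1 (i !) {{i ℕ.!≢0}})

  halves : ∀ x → ½ * x + ½ * x ≡ x
  halves x = trans (sym (ℚ.*-distribʳ-+ x ½ ½)) (ℚ.*-identityˡ x)

  sum≤ : ∀ k → expSum ½ k + ½ ^ℚ k ≤ fromℕ 2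
  sum≤ zero    = ℚ.≤-refl
  sum≤ (suc k) = ℚ.≤-trans
    (ℚ.≤-trans
      (ℚ.≤-reflexive (ℚ.+-assoc (expSum ½ k) (expTerm ½ (suc k)) (½ ^ℚ suc k)))
      (ℚ.+-monoʳ-≤ (expSum ½ k) (ℚ.≤-trans (ℚ.+-monoˡ-≤ (½ ^ℚ suc k) (term≤ (suc k)))
        (ℚ.≤-reflexive (halves (½ ^ℚ k))))))
    (sum≤ k)

  0∈ : L 0ℚ
  0∈ = ½ , 0≤½ , (λ k → ℚ.≤-trans
           (subst (_≤ expSum ½ k + ½ ^ℚ k) (ℚ.+-identityʳ (expSum ½ k))
             (ℚ.+-monoʳ-≤ (expSum ½ k) (0≤^ k 0≤½)))
           (ℚ.≤-trans (sum≤ k) (fromℕ-mono (ℕ.nonTrivial⇒n>1 n)))) ,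
       ℚ.positive⁻¹ ½

  sum₁ : ∀ p → expSum p 1 ≡ 1ℚ + p
  sum₁ p = cong (λ x → 1ℚ + x) (trans (ℚ.*-identityʳ (p * 1ℚ)) (ℚ.*-identityʳ p))

  bnd : ¬ L (fromℕ n)
  bnd (p , 0≤p , sum≤n , n<p) = ℚ.<-irrefl refl $ ℚ.<-≤-trans n<p $ ℚ.≤-trans
    (subst (_≤ 1ℚ + p) (ℚ.+-identityˡ p) (ℚ.+-monoˡ-≤ p (ℚ.<⇒≤ 0<1)))
    (subst (_≤ fromℕ n) (sum₁ p) (sum≤n 1))

record EdgeSet (n : ℕ) : Set where
  field
    adj    : Fin n → Fin n → Bool
    symm   : ∀ u v → adj u v ≡ adj v u
    irrefl : ∀ v → adj v v ≡ false

open EdgeSet public using (adj)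

-- A finite simple graph whose vertex set is a subset of Fin n.
record Graph (n : ℕ) : Set where
  field
    V         : Subset n
    E         : EdgeSet n
    endpoints : ∀ {u v} → T (adj E u v) → u ∈ V

open Graph public using (V; E)

infix 4 _⊆E_ _⊆G_

_⊆E_ : ∀ {n} → EdgeSet n → EdgeSet n → Set
F ⊆E F′ = ∀ {u v} → T (adj F u v) → T (adj F′ u v)

_⊆G_ : ∀ {n} → Graph n → Graph n → Set
H ⊆G G = V H ⊆ V G × E H ⊆E E G

K : ∀ n → Graph n
K n = record
  { V         = full
  ; E         = record
    { adj    = λ u v → not (does (u Fin.≟ v))
    ; symm   = λ u v → cong not (≟-sym u v)
    ; irrefl = λ v → cong not (≟-refl v)
    }
  ; endpoints = λ _ → ∈⊤
  }
  where
  ≟-refl : ∀ v → does (v Fin.≟ v) ≡ true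
  ≟-refl v with v Fin.≟ v
  ... | yes _  = refl
  ... | no v≢v = contradiction refl v≢v

  ≟-sym : ∀ u v → does (u Fin.≟ v) ≡ does (v Fin.≟ u)
  ≟-sym u v with u Fin.≟ v | v Fin.≟ u
  ... | yes _    | yes _    = refl
  ... | no _     | no _     = refl
  ... | yes u≡v  | no v≢u   = contradiction (sym u≡v) v≢u
  ... | no u≢v   | yes v≡u  = contradiction (sym v≡u) u≢v

-- The graph (V(Y), F).
spanning : ∀ {n} (Y : Graph n) (F : EdgeSet n) → F ⊆E E Y → Graph n
spanning Y F F⊆E = record { V = V Y ; E = F ; endpoints = Graph.endpoints Y ∘ F⊆E }

infixl 6 _─_
_─_ : ∀ {n} → Graph n → EdgeSet n → Graph n
Y ─ F = record
  { V         = V Y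
  ; E         = record
    { adj    = λ u v → adj (E Y) u v ∧ not (adj F u v)
    ; symm   = λ u v → cong₂ _∧_ (EdgeSet.symm (E Y) u v) (cong not (EdgeSet.symm F u v))
    ; irrefl = λ v → cong (_∧ not (adj F v v)) (EdgeSet.irrefl (E Y) v)
    }
  ; endpoints = Graph.endpoints Y ∘ proj₁ ∘ Equivalence.to T-∧
  }

edgeless : ∀ n → Graph n
edgeless n = record
  { V         = none
  ; E         = record { adj = λ _ _ → false ; symm = λ _ _ → refl ; irrefl = λ _ → refl }
  ; endpoints = λ ()
  }

degree : ∀ {n} → Graph n → Fin n → ℕ
degree G v = ∣ tabulate (adj (E G) v) ∣

-- Elements of Fin n outside V G have degree 0.
Δ : ∀ {n} → Graph n → ℕ
Δ {n} G = max 0 (map (degree G) (allFin n))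

Adj : ∀ {n} → Graph n → Fin n → Fin n → Set
Adj G u v = T (adj (E G) u v)

IsCycle : ∀ {n k} → Graph n → Vec (Fin n) k → Set
IsCycle             G []         = ⊥
IsCycle {k = k} G vs@(v ∷ _) = 3 ℕ.≤ k × Unique vs × Linked (Adj G) (vs ∷ʳ v)

HasCycle : ∀ {n} → Graph n → ℕ → Set
HasCycle {n} G k = ∃[ vs ] IsCycle {n} {k} G vs

isCycle? : ∀ {n k} (G : Graph n) → Decidable (IsCycle {n} {k} G)
isCycle?         G []         = no λ ()
isCycle? {k = k} G vs@(v ∷ _) =
  (3 ℕ.≤? k) ×-dec allPairs? (λ u w → ¬? (u Fin.≟ w)) vs ×-dec linked? (λ _ _ → T? _) (vs ∷ʳ v)

anyVec? : ∀ {n k} {P : Vec (Fin n) k → Set} → Decidable P → Dec (∃ P)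
anyVec? {k = zero}  P? = map′ ([] ,_) (λ { ([] , p) → p }) (P? [])
anyVec? {k = suc k} P? = map′
  (λ { (x , xs , p) → (x ∷ xs) , p })
  (λ { (x ∷ xs , p) → x , xs , p })
  (Fin.any? λ x → anyVec? (P? ∘ (x ∷_)))

hasCycle? : ∀ {n} (G : Graph n) → Decidable (HasCycle G)
hasCycle? G k = anyVec? (isCycle? G)

-- The length of a shortest cycle, or ⊤⁺ for a forest; vertices on a cycle are
-- distinct, so only lengths up to n need to be searched.
girth : ∀ {n} → Graph n → ℕ ⁺
girth {n} G = head (filter (hasCycle? G) (upTo (suc n)))

Independent : ∀ {n} → Graph n → Subset n → Set
Independent G S = S ⊆ V G × (∀ u v → u ∈ S → v ∈ S → ¬ Adj G u v)

independent? : ∀ {n} (G : Graph n) → Decidable (Independent G)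
independent? G S = (S ⊆? V G) ×-dec
  Fin.all? λ u → Fin.all? λ v → (u ∈? S) →-dec (v ∈? S) →-dec ¬? (T? _)

∑ : ∀ {n} → (Subset n → ℚ) → ℚ
∑ {zero}  f = f []
∑ {suc n} f = ∑ (f ∘ (inside ∷_)) + ∑ (f ∘ (outside ∷_))

-- Rational weights give the same infimum as real ones.
record FractionalColouring {n} (G : Graph n) : Set where
  field
    weight      : Subset n → ℚ
    weight≥0    : ∀ S → 0ℚ ≤ weight S
    support     : ∀ S → ¬ Independent G S → weight S ≡ 0ℚ
    covers      : ∀ v → v ∈ V G → 1ℚ ≤ ∑ λ S → if does (v ∈? S) then weight S else 0ℚ

  total : ℚ
  total = ∑ weight

open FractionalColouring public using (total)

∑-mono : ∀ {n} {f g : Subset n → ℚ} → (∀ S → f S ≤ g S) → ∑ f ≤ ∑ g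
∑-mono {zero}  f≤g = f≤g []
∑-mono {suc n} f≤g = ℚ.+-mono-≤ (∑-mono (f≤g ∘ (inside ∷_))) (∑-mono (f≤g ∘ (outside ∷_)))

∑-nonneg : ∀ {n} {f : Subset n → ℚ} → (∀ S → 0ℚ ≤ f S) → 0ℚ ≤ ∑ f
∑-nonneg {zero}  0≤f = 0≤f []
∑-nonneg {suc n} 0≤f = ℚ.+-mono-≤ (∑-nonneg (0≤f ∘ (inside ∷_))) (∑-nonneg (0≤f ∘ (outside ∷_)))

term≤∑ : ∀ {n} {f : Subset n → ℚ} → (∀ S → 0ℚ ≤ f S) → ∀ S → f S ≤ ∑ f
term≤∑ {zero}  0≤f []            = ℚ.≤-refl
term≤∑ {suc n} {f} 0≤f (true ∷ S) = ℚ.≤-trans (term≤∑ (0≤f ∘ (inside ∷_)) S)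
  (ℚ.≤-trans (ℚ.≤-reflexive (sym (ℚ.+-identityʳ _)))
    (ℚ.+-monoʳ-≤ (∑ (f ∘ (inside ∷_))) (∑-nonneg (0≤f ∘ (outside ∷_)))))
term≤∑ {suc n} {f} 0≤f (false ∷ S) = ℚ.≤-trans (term≤∑ (0≤f ∘ (outside ∷_)) S)
  (ℚ.≤-trans (ℚ.≤-reflexive (sym (ℚ.+-identityˡ _)))
    (ℚ.+-monoˡ-≤ (∑ (f ∘ (outside ∷_))) (∑-nonneg (0≤f ∘ (inside ∷_)))))

unitColouring : ∀ {n} (G : Graph n) → FractionalColouring G
unitColouring {n} G = record
  { weight      = w
  ; weight≥0    = 0≤w
  ; support     = w-support
  ; covers      = λ v v∈V → ℚ.≤-trans (singleton v v∈V)
      (term≤∑ (λ S → 0≤if (does (v ∈? S)) (0≤w S)) ⁅ v ⁆)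
  }
  where
  w : Subset n → ℚ
  w S = if does (independent? G S) then 1ℚ else 0ℚ

  0≤if : ∀ b {x} → 0ℚ ≤ x → 0ℚ ≤ (if b then x else 0ℚ)
  0≤if true  0≤x = 0≤x
  0≤if false 0≤x = ℚ.≤-refl

  0≤w : ∀ S → 0ℚ ≤ w S
  0≤w S = 0≤if (does (independent? G S)) (ℚ.<⇒≤ 0<1)

  if-yes : ∀ {P : Set} (P? : Dec P) {x y : ℚ} → P → (if does P? then x else y) ≡ x
  if-yes (yes _) p = refl
  if-yes (no ¬p) p = contradiction p ¬p

  if-no : ∀ {P : Set} (P? : Dec P) {x y : ℚ} → ¬ P → (if does P? then x else y) ≡ y
  if-no (yes p) ¬p = contradiction p ¬p
  if-no (no _)  ¬p = refl

  w-support : ∀ S → ¬ Independent G S → w S ≡ 0ℚ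
  w-support S = if-no (independent? G S)

  singleton-independent : ∀ v → v ∈ V G → Independent G ⁅ v ⁆
  singleton-independent v v∈V =
      (λ x∈ → subst (_∈ V G) (sym (x∈⁅y⁆⇒x≡y v x∈)) v∈V)
    , λ x y x∈ y∈ xy → subst T (EdgeSet.irrefl (E G) v)
        (subst₂ (Adj G) (x∈⁅y⁆⇒x≡y v x∈) (x∈⁅y⁆⇒x≡y v y∈) xy)

  singleton : ∀ v → v ∈ V G → 1ℚ ≤ (if does (v ∈? ⁅ v ⁆) then w ⁅ v ⁆ else 0ℚ)
  singleton v v∈V = ℚ.≤-reflexive $ sym $
    trans (if-yes (v ∈? ⁅ v ⁆) (x∈⁅x⁆ v))
          (if-yes (independent? G ⁅ v ⁆) (singleton-independent v v∈V))

unitColouring-total≤ : ∀ {n} (G : Graph n) → total (unitColouring G) ≤ ∑ {n} (λ _ → 1ℚ)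
unitColouring-total≤ G = ∑-mono λ S → if≤1 (does (independent? G S))
  where
  if≤1 : ∀ b → (if b then 1ℚ else 0ℚ) ≤ 1ℚ
  if≤1 true  = ℚ.≤-refl
  if≤1 false = ℚ.<⇒≤ 0<1

-- The infimum of the total weights of fractional colourings.
χᶠ : ∀ {n} → Graph n → ℝ
χᶠ G = record
  { Lower     = λ q → ∃[ p ] (q < p × ∀ (c : FractionalColouring G) → p ≤ total c)
  ; inhabited = 0ℚ - 1ℚ , 0ℚ , q-1<q 0ℚ , λ c → ∑-nonneg (FractionalColouring.weight≥0 c)
  ; bounded   = total (unitColouring G) , λ (p , q<p , p≤) →
      ℚ.<-irrefl refl (ℚ.<-≤-trans q<p (p≤ (unitColouring G)))
  ; downward  = λ q′<q (p , q<p , p≤) → p , ℚ.<-trans q′<q q<p , p≤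
  ; rounded   = λ (p , q<p , p≤) → let m , q<m , m<p = ℚ.<-dense q<p in m , q<m , p , m<p , p≤
  }

edgeless-girth : ∀ n → girth (edgeless n) ≡ ⊤⁺
edgeless-girth n = cong head (filter-none (hasCycle? (edgeless n)) (List.universal acyclic (upTo (suc n))))
  where
  acyclic : ∀ k → ¬ HasCycle (edgeless n) k
  acyclic _ ((_ ∷ [])    , s≤s () , _)
  acyclic _ ((_ ∷ _ ∷ _) , _ , _ , () ∷ _)

-- The supremum of χᶠ(H) over subgraphs H of G with girth H ≥ r, which is a
-- maximum because there are finitely many of these; as lower sets, a union.
hᶠ : ∀ {n} → ℕ → Graph n → ℝ
hᶠ {n} r G = record
  { Lower     = λ q → ∃[ H ] (H ⊆G G × [ r ] ≤⁺ girth H × Lower (χᶠ H) q)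
  ; inhabited =
      let q , q∈ = inhabited (χᶠ (edgeless n))
      in q , edgeless n , (⊥⊆ , λ ()) , subst ([ r ] ≤⁺_) (sym (edgeless-girth n)) (_ ≤⊤⁺) , q∈
  ; bounded   = ∑ {n} (λ _ → 1ℚ) , λ (H , _ , _ , p , B<p , p≤) → ℚ.<-irrefl refl
      (ℚ.<-≤-trans B<p (ℚ.≤-trans (p≤ (unitColouring H)) (unitColouring-total≤ H)))
  ; downward  = λ q′<q (H , H⊆G , g , q∈) → H , H⊆G , g , downward (χᶠ H) q′<q q∈
  ; rounded   = λ (H , H⊆G , g , q∈) →
      let m , q<m , m∈ = rounded (χᶠ H) q∈ in m , q<m , H , H⊆G , g , m∈
  }

1/2[r-1] : (r : ℕ) → 4 ℕ.≤ r → ℚ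
1/2[r-1] r 4≤r = (+ 1 / (2 ℕ.* (r ∸ 1))) {{ℕ.m*n≢0 2 (r ∸ 1) {{_}} {{r-1≢0}}}}
  where
  r-1≢0 : ℕ.NonZero (r ∸ 1)
  r-1≢0 = ℕ.>-nonZero (ℕ.∸-monoˡ-≤ 1 (ℕ.≤-trans (s≤s (s≤s z≤n)) 4≤r))

{-# OPTIONS --safe #-}
-- F can be taken empty: we build Y of girth at least r with no large independent set.
-- Put k = r - 2 and add edges one at a time, always between two vertices of degree below
-- D = 8x² at distance more than k, so that no cycle of length at most k + 1 ever appears.
-- Balls of radius k have at most n/x elements or so.  Hence every independent set of about
-- 2n/x vertices of degree below D spans a proportion of at least 1/x² of all pairs as
-- admissible edges, and some admissible edge destroys that proportion of these sets.
-- There are at most 2^n of them, so they are exhausted within x² (n + 1) steps.  By then at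
-- most half of the vertices have degree D; on the remaining ones χᶠ is at least
-- (n/2) / (4n/x) = x/8.  Since δ < 1/(2(r-1)), the crude count 2^n is affordable:
-- x can be chosen proportional to n^(1/(2(r-1))) ≥ n^δ, and dividing by log n ≥ ½ is harmless.
module Submission where

open import Defs
open import Data.Nat.Base using (ℕ; _≤_; NonTrivial)
open import Data.Product using (Σ-syntax; ∃-syntax; _×_)
open import Relation.Binary.Construct.Add.Supremum.NonStrict _≤_ using (_≤⁺_)
open import Relation.Nullary.Construct.Add.Supremum using ([_])

import Algebra.Properties.CommutativeSemigroup as CommutativeSemigroup
open import Algebra.Bundles using (CommutativeMonoid)
open import Data.Bool.Base using (true; false; if_then_else_; T)
open import Data.Bool.Properties using (T-∧)
open import Data.Empty using (⊥)
open import Data.Fin.Base using (Fin; suc)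
import Data.Fin.Properties as Fin
open import Data.Fin.Subset using (Subset; ∣_∣; inside; outside; ⁅_⁆) renaming (_∈_ to _∈ˢ_)
open import Data.Fin.Subset.Properties using (∈⊤; x∈⁅x⁆; ∣⁅x⁆∣≡1) renaming (_∈?_ to _∈ˢ?_)
open import Data.Integer.Base as ℤ using ()
import Data.Integer.Properties as ℤ
open import Data.List.Base
  using (List; []; _∷_; _++_; map; length; filter; concatMap; cartesianProduct; tabulate; allFin; head; upTo)
open import Data.List.Extrema.Nat using (max≤v⁺)
open import Data.List.Membership.Propositional using (_∈_)
open import Data.List.Membership.Propositional.Properties using (∈-++⁺ˡ; ∈-++⁺ʳ; ∈-map⁺; ∈-concatMap⁺)
open import Data.List.Properties using (map-++; map-∘; map-tabulate; length-++; length-map; length-tabulate)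
open import Data.List.Relation.Unary.All as All using (All; []; _∷_; universal)
open import Data.List.Relation.Unary.All.Properties using (all-filter; map⁺)
open import Data.List.Relation.Unary.Any as Any using (Any; here; there; any?)
open import Data.Nat.Base hiding (_≤_)
open import Data.Nat.DivMod using (m≡m%n+[m/n]*n; m%n<n; m/n*n≤m)
open import Data.Nat.ListAction using (sum)
open import Data.Nat.ListAction.Properties using (sum-++)
open import Data.Nat.Properties as ℕ hiding (*-mono-≤)
open import Data.Nat.Tactic.RingSolver using (solve-∀)
open import Data.Product using (_,_; proj₁; proj₂)
open import Data.Rational.Base as ℚ using (ℚ; 0ℚ; 1ℚ)
import Data.Rational.Properties as ℚ
open import Data.Rational.Unnormalised.Base as ℚᵘ using (mkℚᵘ)
import Data.Rational.Unnormalised.Properties as ℚᵘ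
open import Data.Sum.Base using (_⊎_; inj₁; inj₂; swap)
open import Data.Vec.Base as Vec using (Vec; []; _∷_; _∷ʳ_)
open import Data.Vec.Properties using ([]=⇒lookup; lookup⇒[]=; lookup∘tabulate)
import Data.Vec.Relation.Unary.All as VecAll
open import Data.Vec.Relation.Unary.AllPairs using (_∷_)
open import Data.Vec.Relation.Unary.Linked using (Linked; [-]; _∷_)
open import Function using (_∘_; id; it; Equivalence)
open import Relation.Binary.Construct.Add.Supremum.NonStrict _≤_ using ([_]; _≤⊤⁺)
open import Relation.Binary.PropositionalEquality
open import Relation.Nullary using (¬_; Dec; yes; no; does; contradiction)
open import Relation.Nullary.Decidable
  using (¬?; _×-dec_; _⊎-dec_; _→-dec_; map′; does-≡; dec-true; dec-false; decidable-stable)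
open import Relation.Unary using (Decidable)

private
  module +ℕ = CommutativeSemigroup ℕ.+-commutativeSemigroup
  module *ℕ = CommutativeSemigroup ℕ.*-commutativeSemigroup
  module +ℚ = CommutativeSemigroup (CommutativeMonoid.commutativeSemigroup ℚ.+-0-commutativeMonoid)

private variable
  A B : Set
  R R′ : A → A → Set
  n k : ℕ

-- Finite sums

sumOver : List A → (A → ℕ) → ℕ
sumOver xs f = sum (map f xs)

sumOver-mono : ∀ (xs : List A) {f g} → (∀ x → f x ≤ g x) → sumOver xs f ≤ sumOver xs g
sumOver-mono []       f≤g = z≤n
sumOver-mono (x ∷ xs) f≤g = +-mono-≤ (f≤g x) (sumOver-mono xs f≤g)

sumOver-cong : ∀ (xs : List A) {f g} → (∀ x → f x ≡ g x) → sumOver xs f ≡ sumOver xs g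
sumOver-cong []       f≡g = refl
sumOver-cong (x ∷ xs) f≡g = cong₂ _+_ (f≡g x) (sumOver-cong xs f≡g)

sumOver-+ : ∀ (xs : List A) f g → sumOver xs (λ x → f x + g x) ≡ sumOver xs f + sumOver xs g
sumOver-+ []       f g = refl
sumOver-+ (x ∷ xs) f g =
  trans (cong (f x + g x +_) (sumOver-+ xs f g)) (+ℕ.interchange (f x) (g x) _ _)

sumOver-*ˡ : ∀ (xs : List A) c f → sumOver xs (λ x → c * f x) ≡ c * sumOver xs f
sumOver-*ˡ []       c f = sym (*-zeroʳ c)
sumOver-*ˡ (x ∷ xs) c f =
  trans (cong (c * f x +_) (sumOver-*ˡ xs c f)) (sym (*-distribˡ-+ c (f x) _))

sumOver-*ʳ : ∀ (xs : List A) c f → sumOver xs (λ x → f x * c) ≡ sumOver xs f * c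
sumOver-*ʳ xs c f = trans (sumOver-cong xs (λ x → *-comm (f x) c))
  (trans (sumOver-*ˡ xs c f) (*-comm c _))

sumOver-const : ∀ (xs : List A) c → sumOver xs (λ _ → c) ≡ length xs * c
sumOver-const []       c = refl
sumOver-const (x ∷ xs) c = cong (c +_) (sumOver-const xs c)

sumOver-swap : ∀ (xs : List A) (ys : List B) (f : A → B → ℕ) →
  sumOver xs (λ x → sumOver ys (f x)) ≡ sumOver ys (λ y → sumOver xs (λ x → f x y))
sumOver-swap []       ys f = sym (trans (sumOver-const ys 0) (*-zeroʳ (length ys)))
sumOver-swap (x ∷ xs) ys f = trans (cong (sumOver ys (f x) +_) (sumOver-swap xs ys f))
  (sym (sumOver-+ ys (f x) _))

sumOver-++ : ∀ (xs ys : List A) f → sumOver (xs ++ ys) f ≡ sumOver xs f + sumOver ys f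
sumOver-++ xs ys f = trans (cong sum (map-++ f xs ys)) (sum-++ (map f xs) (map f ys))

sumOver-map : ∀ (xs : List A) (h : A → B) f → sumOver (map h xs) f ≡ sumOver xs (f ∘ h)
sumOver-map xs h f = cong sum (sym (map-∘ xs))

sumOver-cartesianProduct : ∀ (xs : List A) (ys : List B) f →
  sumOver (cartesianProduct xs ys) f ≡ sumOver xs (λ x → sumOver ys (λ y → f (x , y)))
sumOver-cartesianProduct []       ys f = refl
sumOver-cartesianProduct (x ∷ xs) ys f =
  trans (sumOver-++ (map (x ,_) ys) (cartesianProduct xs ys) f)
        (cong₂ _+_ (sumOver-map ys (x ,_) f) (sumOver-cartesianProduct xs ys f))

term≤sumOver : ∀ {xs : List A} f {x} → x ∈ xs → f x ≤ sumOver xs f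
term≤sumOver f (here refl)            = m≤m+n _ _
term≤sumOver f {x} (there {y} x∈xs) = ≤-trans (term≤sumOver f x∈xs) (m≤n+m _ (f y))

positive-term : ∀ (xs : List A) f → 0 < sumOver xs f → ∃[ x ] 0 < f x
positive-term (x ∷ xs) f 0<Σ with f x in eq
... | zero  = positive-term xs f 0<Σ
... | suc _ = x , subst (0 <_) (sym eq) z<s

-- The witness is a largest term: the head is compared with the best term of the tail.
average : ∀ (xs : List A) f → 0 < length xs → ∃[ x ] sumOver xs f ≤ length xs * f x
average (x ∷ [])           f _ = x , ≤-refl
average (x ∷ xs@(_ ∷ _)) f _ with average xs f z<s
... | y , Σ≤ with ≤-total (f x) (f y)
...   | inj₁ fx≤fy = y , +-mono-≤ fx≤fy Σ≤
...   | inj₂ fy≤fx = x , +-monoʳ-≤ (f x) (≤-trans Σ≤ (*-monoʳ-≤ (length xs) fy≤fx))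

𝟙 : {P : Set} → Dec P → ℕ
𝟙 P? = if does P? then 1 else 0

𝟙-yes : {P : Set} (P? : Dec P) → P → 𝟙 P? ≡ 1
𝟙-yes (yes _) p = refl
𝟙-yes (no ¬p) p = contradiction p ¬p

𝟙-no : {P : Set} (P? : Dec P) → ¬ P → 𝟙 P? ≡ 0
𝟙-no (yes p) ¬p = contradiction p ¬p
𝟙-no (no _)  ¬p = refl

𝟙-mono : {P Q : Set} (P? : Dec P) (Q? : Dec Q) → (P → Q) → 𝟙 P? ≤ 𝟙 Q?
𝟙-mono (yes p) Q? P⇒Q = ≤-reflexive (sym (𝟙-yes Q? (P⇒Q p)))
𝟙-mono (no _)  Q? P⇒Q = z≤n

𝟙≤1 : {P : Set} (P? : Dec P) → 𝟙 P? ≤ 1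
𝟙≤1 (yes _) = ≤-refl
𝟙≤1 (no _)  = z≤n

𝟙-witness : {P : Set} (P? : Dec P) → 0 < 𝟙 P? → P
𝟙-witness (yes p) _ = p

-- Double counting of incidences weighted by h. Each b of positive weight meets at least t of at
-- most w t elements a, so an average a meets a proportion 1/w of the total weight.
pigeonhole : ∀ (as : List A) (bs : List B) (χ : A → B → ℕ) (h : B → ℕ) t w .{{_ : NonZero t}} →
  0 < length as → length as ≤ w * t →
  (∀ b → t * h b ≤ sumOver as (λ a → χ a b) * h b) →
  ∃[ a ] sumOver bs h ≤ w * sumOver bs (λ b → χ a b * h b)
pigeonhole as bs χ h t w as≢[] as≤wt t≤ with average as (λ a → sumOver bs (λ b → χ a b * h b)) as≢[]
... | a , Σ≤ = a , *-cancelˡ-≤ t (begin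
  t * sumOver bs h                                          ≡⟨ sumOver-*ˡ bs t h ⟨
  sumOver bs (λ b → t * h b)                                ≤⟨ sumOver-mono bs t≤ ⟩
  sumOver bs (λ b → sumOver as (λ a → χ a b) * h b)         ≡⟨ sumOver-cong bs (λ b → sym (sumOver-*ʳ as (h b) (λ a → χ a b))) ⟩
  sumOver bs (λ b → sumOver as (λ a → χ a b * h b))         ≡⟨ sumOver-swap bs as _ ⟩
  sumOver as (λ a → sumOver bs (λ b → χ a b * h b))         ≤⟨ Σ≤ ⟩
  length as * g                                             ≤⟨ *-monoˡ-≤ g as≤wt ⟩
  w * t * g                                                 ≡⟨ rearrange w t g ⟩
  t * (w * g)                                               ∎)
  where
  open ≤-Reasoning
  g = sumOver bs (λ b → χ a b * h b)
  rearrange : ∀ w t g → w * t * g ≡ t * (w * g)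
  rearrange = solve-∀

-- Vertices and vertex sets

card≡sumOver : (S : Subset n) → sumOver (allFin n) (λ v → 𝟙 (v ∈ˢ? S)) ≡ ∣ S ∣
card≡sumOver []      = refl
card≡sumOver {suc n} (b ∷ S) with tail ← trans
    (cong sum (trans (map-tabulate suc (λ v → 𝟙 (v ∈ˢ? (b ∷ S))))
                     (sym (map-tabulate id (λ v → 𝟙 (v ∈ˢ? S))))))
    (card≡sumOver S) | b
... | true  = cong suc tail
... | false = tail

sumOver-≟ : (u : Fin n) → sumOver (allFin n) (λ v → 𝟙 (v Fin.≟ u)) ≤ 1
sumOver-≟ {n} u = ≤-trans
  (sumOver-mono (allFin n) (λ v → 𝟙-mono (v Fin.≟ u) (v ∈ˢ? ⁅ u ⁆) λ { refl → x∈⁅x⁆ u }))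
  (≤-reflexive (trans (card≡sumOver ⁅ u ⁆) (∣⁅x⁆∣≡1 u)))

_∈?_ : (v : Fin n) (xs : List (Fin n)) → Dec (v ∈ xs)
v ∈? xs = any? (v Fin.≟_) xs

-- An element of S that lies in xs is charged to one of its occurrences there, so repetitions in xs
-- do no harm; balls are lists with repetitions.
card-avoiding : (S : Subset n) (xs : List (Fin n)) →
  ∣ S ∣ ≤ sumOver (allFin n) (λ v → 𝟙 (v ∈ˢ? S) * 𝟙 (¬? (v ∈? xs))) + length xs
card-avoiding {n} S xs = begin
  ∣ S ∣
    ≡⟨ card≡sumOver S ⟨
  sumOver (allFin n) (λ v → 𝟙 (v ∈ˢ? S))
    ≤⟨ sumOver-mono (allFin n) pointwise ⟩
  sumOver (allFin n) (λ v → avoiding v + occurrences v)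
    ≡⟨ sumOver-+ (allFin n) avoiding occurrences ⟩
  sumOver (allFin n) avoiding + sumOver (allFin n) occurrences
    ≤⟨ +-monoʳ-≤ (sumOver (allFin n) avoiding) total-occurrences ⟩
  sumOver (allFin n) avoiding + length xs
    ∎
  where
  open ≤-Reasoning
  avoiding occurrences : Fin n → ℕ
  avoiding v    = 𝟙 (v ∈ˢ? S) * 𝟙 (¬? (v ∈? xs))
  occurrences v = sumOver xs (λ x → 𝟙 (v Fin.≟ x))

  pointwise : ∀ v → 𝟙 (v ∈ˢ? S) ≤ avoiding v + occurrences v
  pointwise v with v ∈? xs
  ... | no _     = ≤-trans (≤-reflexive (sym (*-identityʳ _))) (m≤m+n _ _)
  ... | yes v∈xs = begin
    𝟙 (v ∈ˢ? S)                      ≤⟨ 𝟙≤1 (v ∈ˢ? S) ⟩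
    1                                ≡⟨ 𝟙-yes (v Fin.≟ v) refl ⟨
    𝟙 (v Fin.≟ v)                    ≤⟨ term≤sumOver (λ x → 𝟙 (v Fin.≟ x)) v∈xs ⟩
    occurrences v                    ≤⟨ m≤n+m _ (𝟙 (v ∈ˢ? S) * 0) ⟩
    𝟙 (v ∈ˢ? S) * 0 + occurrences v  ∎

  total-occurrences : sumOver (allFin n) occurrences ≤ length xs
  total-occurrences = begin
    sumOver (allFin n) occurrences
      ≡⟨ sumOver-swap (allFin n) xs (λ v x → 𝟙 (v Fin.≟ x)) ⟩
    sumOver xs (λ x → sumOver (allFin n) (λ v → 𝟙 (v Fin.≟ x)))
      ≤⟨ sumOver-mono xs sumOver-≟ ⟩
    sumOver xs (λ _ → 1)
      ≡⟨ trans (sumOver-const xs 1) (*-identityʳ (length xs)) ⟩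
    length xs
      ∎

subsets : ∀ n → List (Subset n)
subsets zero    = [] ∷ []
subsets (suc n) = map (inside ∷_) (subsets n) ++ map (outside ∷_) (subsets n)

∈-subsets : (S : Subset n) → S ∈ subsets n
∈-subsets []            = here refl
∈-subsets (inside ∷ S)  = ∈-++⁺ˡ (∈-map⁺ (inside ∷_) (∈-subsets S))
∈-subsets (outside ∷ S) = ∈-++⁺ʳ _ (∈-map⁺ (outside ∷_) (∈-subsets S))

length-subsets : ∀ n → length (subsets n) ≡ 2 ^ n
length-subsets zero    = refl
length-subsets (suc n) = begin
  length (subsets (suc n))                  ≡⟨ length-++ (map (inside ∷_) (subsets n)) ⟩
  length (map (inside ∷_) (subsets n)) + length (map (outside ∷_) (subsets n))
    ≡⟨ cong₂ _+_ (length-map (inside ∷_) (subsets n)) (length-map (outside ∷_) (subsets n)) ⟩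
  length (subsets n) + length (subsets n)   ≡⟨ cong (λ l → l + l) (length-subsets n) ⟩
  2 ^ n + 2 ^ n                             ≡⟨ cong (2 ^ n +_) (+-identityʳ (2 ^ n)) ⟨
  2 ^ suc n                                 ∎
  where open ≡-Reasoning

-- Walks and edge lists

-- The index is an upper bound for the length, not the length itself: `[]` has every index.
data Walk (R : A → A → Set) : ℕ → A → A → Set where
  []  : ∀ {x} → Walk R k x x
  _∷_ : ∀ {x y z} → R x y → Walk R k y z → Walk R (suc k) x z

walk-mono : ∀ {i j} {x y : A} → i ≤ j → Walk R i x y → Walk R j x y
walk-mono i≤j       []      = []
walk-mono (s≤s i≤j) (r ∷ w) = r ∷ walk-mono i≤j w

walk-map : ∀ {x y : A} → (∀ {a b} → R a b → R′ a b) → Walk R k x y → Walk R′ k x y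
walk-map R⇒R′ []      = []
walk-map R⇒R′ (r ∷ w) = R⇒R′ r ∷ walk-map R⇒R′ w

_++ʷ_ : ∀ {i j} {x y z : A} → Walk R i x y → Walk R j y z → Walk R (i + j) x z
_++ʷ_ {i = i} {j} [] w = walk-mono (m≤n+m j i) w
(r ∷ v) ++ʷ w = r ∷ (v ++ʷ w)

reverse : ∀ {x y : A} → (∀ {a b} → R a b → R b a) → Walk R k x y → Walk R k y x
reverse R-sym [] = []
reverse {k = suc k} R-sym (r ∷ w) =
  walk-mono (≤-reflexive (+-comm k 1)) (reverse R-sym w ++ʷ (R-sym r ∷ []))

Edge : ℕ → Set
Edge n = Fin n × Fin n

-- Edges are stored as ordered pairs; this relation forgets the orientation.
infix 4 _≋_
_≋_ : Edge n → Edge n → Set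
(a , b) ≋ (x , y) = (a ≡ x × b ≡ y) ⊎ (a ≡ y × b ≡ x)

_≋?_ : (e f : Edge n) → Dec (e ≋ f)
(a , b) ≋? (x , y) = (a Fin.≟ x ×-dec b Fin.≟ y) ⊎-dec (a Fin.≟ y ×-dec b Fin.≟ x)

Link : List (Edge n) → Fin n → Fin n → Set
Link es x y = Any ((x , y) ≋_) es

link? : (es : List (Edge n)) (x y : Fin n) → Dec (Link es x y)
link? es x y = any? ((x , y) ≋?_) es

link-sym : {es : List (Edge n)} {x y : Fin n} → Link es x y → Link es y x
link-sym = Any.map λ { (inj₁ (p , q)) → inj₂ (q , p) ; (inj₂ (p , q)) → inj₁ (q , p) }

-- Multiplicities are kept: a repeated edge counts again and a loop counts twice. This makes `deg`
-- additive in the list of edges, which gives the handshake bound `sum-deg`.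
neighbours : List (Edge n) → Fin n → List (Fin n)
neighbours []             x = []
neighbours ((u , v) ∷ es) x =
  (if does (x Fin.≟ u) then v ∷ [] else []) ++
  (if does (x Fin.≟ v) then u ∷ [] else []) ++ neighbours es x

deg : List (Edge n) → Fin n → ℕ
deg es x = length (neighbours es x)

∈-neighbours : (es : List (Edge n)) {x y : Fin n} → Link es x y → y ∈ neighbours es x
∈-neighbours ((u , v) ∷ es) {x} (here (inj₁ (refl , refl))) with x Fin.≟ x
... | yes _  = here refl
... | no x≢x = contradiction refl x≢x
∈-neighbours ((u , v) ∷ es) {x} (here (inj₂ (refl , refl))) with x Fin.≟ x
... | yes _  = ∈-++⁺ʳ (if does (x Fin.≟ u) then v ∷ [] else []) (here refl)
... | no x≢x = contradiction refl x≢x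
∈-neighbours ((u , v) ∷ es) {x} (there l) =
  ∈-++⁺ʳ (if does (x Fin.≟ u) then v ∷ [] else [])
    (∈-++⁺ʳ (if does (x Fin.≟ v) then u ∷ [] else []) (∈-neighbours es l))

deg-∷ : ∀ u v (es : List (Edge n)) x →
  deg ((u , v) ∷ es) x ≡ 𝟙 (x Fin.≟ u) + (𝟙 (x Fin.≟ v) + deg es x)
deg-∷ u v es x with x Fin.≟ u | x Fin.≟ v
... | yes _ | yes _ = refl
... | yes _ | no _  = refl
... | no _  | yes _ = refl
... | no _  | no _  = refl

sum-deg : (es : List (Edge n)) → sumOver (allFin n) (deg es) ≤ 2 * length es
sum-deg {n} []             = ≤-reflexive (trans (sumOver-const (allFin n) 0) (*-zeroʳ (length (allFin n))))
sum-deg {n} ((u , v) ∷ es) = begin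
  sumOver (allFin n) (deg ((u , v) ∷ es))
    ≡⟨ sumOver-cong (allFin n) (deg-∷ u v es) ⟩
  sumOver (allFin n) (λ x → 𝟙 (x Fin.≟ u) + (𝟙 (x Fin.≟ v) + deg es x))
    ≡⟨ trans (sumOver-+ (allFin n) _ _) (cong (sumOver (allFin n) (λ x → 𝟙 (x Fin.≟ u)) +_) (sumOver-+ (allFin n) _ _)) ⟩
  sumOver (allFin n) (λ x → 𝟙 (x Fin.≟ u)) +
    (sumOver (allFin n) (λ x → 𝟙 (x Fin.≟ v)) + sumOver (allFin n) (deg es))
    ≤⟨ +-mono-≤ (sumOver-≟ u) (+-mono-≤ (sumOver-≟ v) (sum-deg es)) ⟩
  2 + 2 * length es
    ≡⟨ *-suc 2 (length es) ⟨
  2 * length ((u , v) ∷ es) ∎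
  where open ≤-Reasoning

ball : List (Edge n) → ℕ → Fin n → List (Fin n)
ball es zero    x = x ∷ []
ball es (suc k) x = x ∷ concatMap (ball es k) (neighbours es x)

∈-ball : (es : List (Edge n)) {x y : Fin n} → Walk (Link es) k x y → y ∈ ball es k x
∈-ball {k = zero}  es []      = here refl
∈-ball {k = suc k} es []      = here refl
∈-ball {k = suc k} es (l ∷ w) = there (∈-concatMap⁺ (ball es k) (Any.map (λ { refl → ∈-ball es w }) (∈-neighbours es l)))

length-concatMap≤ : (f : A → List B) {b : ℕ} (xs : List A) → (∀ x → length (f x) ≤ b) →
  length (concatMap f xs) ≤ length xs * b
length-concatMap≤ f []       f≤b = z≤n
length-concatMap≤ f (x ∷ xs) f≤b = ≤-trans (≤-reflexive (length-++ (f x)))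
  (+-mono-≤ (f≤b x) (length-concatMap≤ f xs f≤b))

-- If b ≥ 1 bounds the balls of radius k, then 1 + d b ≤ (1 + d) b bounds those of radius k + 1.
length-ball : (es : List (Edge n)) {d : ℕ} → (∀ x → deg es x ≤ d) →
  ∀ k x → length (ball es k x) ≤ suc d ^ k
length-ball es     deg≤d zero    x = ≤-refl
length-ball es {d} deg≤d (suc k) x = +-mono-≤ (m^n>0 (suc d) k)
  (≤-trans (length-concatMap≤ (ball es k) (neighbours es x) (length-ball es deg≤d k))
           (*-monoˡ-≤ (suc d ^ k) (deg≤d x)))

-- Large girth

Avoiding : List (Edge n) → Edge n → Fin n → Fin n → Set
Avoiding es e a b = Link es a b × ¬ (a , b) ≋ e

-- No walk of length at most k joins the ends of an edge without using it; for simple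
-- graphs this says that every cycle has length at least k + 2.
Sparse : ℕ → List (Edge n) → Set
Sparse k es = ∀ {x y} → Link es x y → ¬ Walk (Avoiding es (x , y)) k x y

-- The two ends of a walk that crosses from u to v. The crossing uses one unit of the length k and
-- need not be an R-step itself.
Through : (A → A → Set) → ℕ → A → A → A → A → Set
Through R k u v x y = ∃[ i ] ∃[ j ] (suc (i + j) ≤ k × Walk R i x u × Walk R j v y)

-- Keep the part of the walk before the first use of uv and the part after the last one.
split-walk : ∀ {x y u v : Fin n} {S : Fin n → Fin n → Set} →
  (∀ {a b} → S a b → R a b ⊎ (a , b) ≋ (u , v)) →
  Walk S k x y → Walk R k x y ⊎ Through R k u v x y ⊎ Through R k v u x y
split-walk S⇒ [] = inj₁ []
split-walk S⇒ (s ∷ w) with S⇒ s | split-walk S⇒ w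
... | inj₁ r | inj₁ w′ = inj₁ (r ∷ w′)
... | inj₁ r | inj₂ (inj₁ (i , j , i+j<k , p , q)) = inj₂ (inj₁ (suc i , j , s≤s i+j<k , r ∷ p , q))
... | inj₁ r | inj₂ (inj₂ (i , j , i+j<k , p , q)) = inj₂ (inj₂ (suc i , j , s≤s i+j<k , r ∷ p , q))
... | inj₂ (inj₁ (refl , refl)) | inj₁ w′ = inj₂ (inj₁ (0 , _ , ≤-refl , [] , w′))
... | inj₂ (inj₁ (refl , refl)) | inj₂ (inj₁ (i , j , i+j<k , p , q)) =
  inj₂ (inj₁ (0 , j , ≤-trans (s≤s (m≤n+m j i)) (m≤n⇒m≤1+n i+j<k) , [] , q))
-- The edge is crossed forth and later back, so q already starts at x and both crossings drop out.
... | inj₂ (inj₁ (refl , refl)) | inj₂ (inj₂ (i , j , i+j<k , p , q)) =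
  inj₁ (walk-mono (≤-trans (m≤n+m j (suc i)) (m≤n⇒m≤1+n i+j<k)) q)
... | inj₂ (inj₂ (refl , refl)) | inj₁ w′ = inj₂ (inj₂ (0 , _ , ≤-refl , [] , w′))
... | inj₂ (inj₂ (refl , refl)) | inj₂ (inj₁ (i , j , i+j<k , p , q)) =
  inj₁ (walk-mono (≤-trans (m≤n+m j (suc i)) (m≤n⇒m≤1+n i+j<k)) q)
... | inj₂ (inj₂ (refl , refl)) | inj₂ (inj₂ (i , j , i+j<k , p , q)) =
  inj₂ (inj₂ (0 , j , ≤-trans (s≤s (m≤n+m j i)) (m≤n⇒m≤1+n i+j<k) , [] , q))

-- If xy is the new edge, a walk avoiding it consists of old edges, against `far`. If xy is old, a
-- walk using uv closes up with xy to a cycle through uv; the rest of that cycle is a short old walk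
-- between u and v, again against `far`.
sparse-∷ : {es : List (Edge n)} {u v : Fin n} →
  Sparse k es → ¬ Walk (Link es) k u v → Sparse k ((u , v) ∷ es)
sparse-∷ {k = k} {es} {u} {v} sparse far {x} {y} xy w = go xy ((x , y) ≋? (u , v))
  where
  far′ : ¬ Walk (Link es) k v u
  far′ = far ∘ reverse link-sym

  -- From b to y, across yx, then from x to a: the edge yx takes the place of the crossing, so the
  -- length is still at most k.
  via : Link es y x → ∀ {a b} → Through (Avoiding es (x , y)) k a b x y → Walk (Link es) k b a
  via yx (i , j , i+j<k , p , q) = walk-mono
    (≤-trans (≤-reflexive (trans (+-suc j i) (cong suc (+-comm j i)))) i+j<k)
    (walk-map proj₁ q ++ʷ (yx ∷ walk-map proj₁ p))

  old : ∀ {a b} → Avoiding ((u , v) ∷ es) (x , y) a b → Avoiding es (x , y) a b ⊎ (a , b) ≋ (u , v)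
  old (here ab , ab≉)  = inj₂ ab
  old (there ab , ab≉) = inj₁ (ab , ab≉)

  go : Link ((u , v) ∷ es) x y → Dec ((x , y) ≋ (u , v)) → ⊥
  go _ (yes (inj₁ (refl , refl))) = far (walk-map new w)
    where
    new : ∀ {a b} → Avoiding ((u , v) ∷ es) (u , v) a b → Link es a b
    new (here ab , ab≉)  = contradiction ab ab≉
    new (there ab , ab≉) = ab
  go _ (yes (inj₂ (refl , refl))) = far′ (walk-map new w)
    where
    new : ∀ {a b} → Avoiding ((u , v) ∷ es) (v , u) a b → Link es a b
    new (here ab , ab≉)  = contradiction (swap ab) ab≉
    new (there ab , ab≉) = ab
  go (here xy)  (no xy≉) = xy≉ xy
  go (there xy) (no xy≉) with split-walk old w
  ... | inj₁ w′         = sparse xy w′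
  ... | inj₂ (inj₁ uv)  = far′ (via (link-sym xy) uv)
  ... | inj₂ (inj₂ vu)  = far (via (link-sym xy) vu)

-- The greedy construction

𝟙-× : {P Q : Set} (P? : Dec P) (Q? : Dec Q) → 𝟙 (P? ×-dec Q?) ≡ 𝟙 P? * 𝟙 Q?
𝟙-× (yes _) (yes _) = refl
𝟙-× (yes _) (no _)  = refl
𝟙-× (no _)  Q?      = refl

𝟙-disjoint : {P Q R : Set} (P? : Dec P) (Q? : Dec Q) (R? : Dec R) →
  (P → R) → (Q → R) → (P → ¬ Q) → 𝟙 P? + 𝟙 Q? ≤ 𝟙 R?
𝟙-disjoint (yes p) Q? R? P⇒R Q⇒R P⇒¬Q =
  ≤-trans (+-monoʳ-≤ 1 (≤-reflexive (𝟙-no Q? (P⇒¬Q p)))) (≤-reflexive (sym (𝟙-yes R? (P⇒R p))))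
𝟙-disjoint (no _) Q? R? P⇒R Q⇒R P⇒¬Q = 𝟙-mono Q? R? Q⇒R

positive-factor : ∀ a {b} → 0 < a * b → 0 < b
positive-factor a {zero}  0<ab = subst (0 <_) (*-zeroʳ a) 0<ab
positive-factor a {suc b} 0<ab = z<s

-- Multiplies the accumulated decay ratio V/W by the ratio b/a of one more step, without division.
geometric-step : ∀ {a b x y z V W} → a * z ≤ b * y → W * y ≤ V * x → (a * W) * z ≤ (b * V) * x
geometric-step {a} {b} {x} {y} {z} {V} {W} az≤by Wy≤Vx = begin
  a * W * z      ≡⟨ shuffle a W z ⟩
  W * (a * z)    ≤⟨ *-monoʳ-≤ W az≤by ⟩
  W * (b * y)    ≡⟨ shuffle b W y ⟨
  b * W * y      ≡⟨ *-assoc b W y ⟩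
  b * (W * y)    ≤⟨ *-monoʳ-≤ b Wy≤Vx ⟩
  b * (V * x)    ≡⟨ *-assoc b V x ⟨
  b * V * x      ∎
  where
  open ≤-Reasoning
  shuffle : ∀ a b c → a * b * c ≡ b * (a * c)
  shuffle = solve-∀

*-𝟙-mono : ∀ {a b} {P : Set} (P? : Dec P) → (P → a ≤ b) → a * 𝟙 P? ≤ b * 𝟙 P?
*-𝟙-mono         (yes p) a≤b = *-monoˡ-≤ 1 (a≤b p)
*-𝟙-mono {a} {b} (no _)  a≤b = ≤-reflexive (trans (*-zeroʳ a) (sym (*-zeroʳ b)))

length-cartesianProduct : (xs : List A) (ys : List B) →
  length (cartesianProduct xs ys) ≡ length xs * length ys
length-cartesianProduct []       ys = refl
length-cartesianProduct (x ∷ xs) ys = trans (length-++ (map (x ,_) ys))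
  (cong₂ _+_ (length-map (x ,_) ys) (length-cartesianProduct xs ys))

^-distribʳ-* : ∀ j a b → (a * b) ^ j ≡ a ^ j * b ^ j
^-distribʳ-* zero    a b = refl
^-distribʳ-* (suc j) a b = trans (cong (a * b *_) (^-distribʳ-* j a b)) (*ℕ.interchange a b (a ^ j) (b ^ j))

-- Bernoulli's inequality (1 + 1/v)^(j+1) ≥ 1 + (j+1)/v, cleared of denominators.
bernoulli : ∀ v j → v ^ suc j + suc j * v ^ j ≤ suc v ^ suc j
bernoulli v zero    = ≤-reflexive (lhs v)
  where
  lhs : ∀ v → v * 1 + 1 ≡ 1 * 1 + v * 1
  lhs = solve-∀
bernoulli v (suc j) = begin
  v * (v * p) + suc (suc j) * (v * p)                     ≤⟨ m≤m+n _ (suc j * p) ⟩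
  v * (v * p) + suc (suc j) * (v * p) + suc j * p         ≡⟨ expand v p j ⟩
  suc v * (v * p + suc j * p)                             ≤⟨ *-monoʳ-≤ (suc v) (bernoulli v j) ⟩
  suc v * suc v ^ suc j                                   ∎
  where
  open ≤-Reasoning
  p = v ^ j
  expand : ∀ v p j → v * (v * p) + suc (suc j) * (v * p) + suc j * p ≡ suc v * (v * p + suc j * p)
  expand = solve-∀

-- This is (1 + 1/v)^(v+1) ≥ 2: in `bernoulli v v` the second summand (v + 1) v^v already exceeds or
-- equals v^(v+1).
halving : ∀ v → 2 * v ^ suc v ≤ suc v ^ suc v
halving v = ≤-trans
  (+-monoʳ-≤ (v ^ suc v) (+-monoˡ-≤ 0 (m≤n+m (v * v ^ v) (v ^ v))))
  (≤-trans (≤-reflexive (cong (v ^ suc v +_) (+-identityʳ _))) (bernoulli v v))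

repeated-halving : ∀ v j → 2 ^ j * v ^ (suc v * j) ≤ suc v ^ (suc v * j)
repeated-halving v j = begin
  2 ^ j * v ^ (suc v * j)       ≡⟨ cong (2 ^ j *_) (^-*-assoc v (suc v) j) ⟨
  2 ^ j * (v ^ suc v) ^ j       ≡⟨ ^-distribʳ-* j 2 (v ^ suc v) ⟨
  (2 * v ^ suc v) ^ j           ≤⟨ ^-monoˡ-≤ j (halving v) ⟩
  (suc v ^ suc v) ^ j           ≡⟨ ^-*-assoc (suc v) (suc v) j ⟩
  suc v ^ (suc v * j)           ∎
  where open ≤-Reasoning

-- Each step leaves at most the proportion v / `suc v` of the bad sets; v is the parameter so that
-- no subtraction occurs. By `n²≤`, any 2h² ordered pairs are at least the proportion 1 / `suc v` of
-- all n² pairs.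
module Greedy (n k D h v : ℕ) .{{_ : NonZero n}} .{{_ : NonZero h}}
  (ball≤h : suc (suc D) ^ k ≤ h) (n²≤ : n * n ≤ suc v * (2 * h * h)) where

  -- The sets that can still become large independent sets of the final graph.
  Bad : List (Edge n) → Subset n → Set
  Bad es S = 2 * h ≤ ∣ S ∣ × (∀ x → x ∈ˢ S → deg es x < D) ×
    (∀ x y → x ∈ˢ S → y ∈ˢ S → ¬ Link es x y)

  abstract
    bad? : ∀ es S → Dec (Bad es S)
    bad? es S = (2 * h ≤? ∣ S ∣) ×-dec
      (Fin.all? λ x → (x ∈ˢ? S) →-dec (deg es x <? D)) ×-dec
      (Fin.all? λ x → Fin.all? λ y → (x ∈ˢ? S) →-dec (y ∈ˢ? S) →-dec ¬? (link? es x y))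

  #bad : List (Edge n) → ℕ
  #bad es = sumOver (subsets n) (λ S → 𝟙 (bad? es S))

  Bounded : List (Edge n) → Set
  Bounded es = ∀ x → deg es x ≤ suc D

  -- Adding such a pair makes S dependent, and it preserves sparseness because y lies outside the
  -- ball around x.
  Hits : List (Edge n) → Edge n → Subset n → Set
  Hits es (x , y) S = x ∈ˢ S × y ∈ˢ S × ¬ (y ∈ ball es k x)

  abstract
    hits? : ∀ es e S → Dec (Hits es e S)
    hits? es (x , y) S = (x ∈ˢ? S) ×-dec (y ∈ˢ? S) ×-dec ¬? (y ∈? ball es k x)

    𝟙-hits : ∀ es x y S →
      𝟙 (hits? es (x , y) S) ≡ 𝟙 (x ∈ˢ? S) * (𝟙 (y ∈ˢ? S) * 𝟙 (¬? (y ∈? ball es k x)))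
    𝟙-hits es x y S =
      trans (𝟙-× (x ∈ˢ? S) ((y ∈ˢ? S) ×-dec ¬? (y ∈? ball es k x)))
            (cong (𝟙 (x ∈ˢ? S) *_) (𝟙-× (y ∈ˢ? S) (¬? (y ∈? ball es k x))))

  -- There are at least 2h choices of x in S. The ball around each has at most h elements, so at
  -- least h elements y of S remain outside it.
  many-hits : ∀ {es} → Bounded es → ∀ {S} → Bad es S →
    2 * h * h ≤ sumOver (cartesianProduct (allFin n) (allFin n)) (λ e → 𝟙 (hits? es e S))
  many-hits {es} bounded {S} (2h≤∣S∣ , _) = begin
    2 * h * h
      ≤⟨ *-monoˡ-≤ h 2h≤∣S∣ ⟩
    ∣ S ∣ * h
      ≡⟨ cong (_* h) (card≡sumOver S) ⟨
    sumOver (allFin n) (λ x → 𝟙 (x ∈ˢ? S)) * h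
      ≡⟨ sumOver-*ʳ (allFin n) h (λ x → 𝟙 (x ∈ˢ? S)) ⟨
    sumOver (allFin n) (λ x → 𝟙 (x ∈ˢ? S) * h)
      ≤⟨ sumOver-mono (allFin n) (λ x → *-monoʳ-≤ (𝟙 (x ∈ˢ? S)) (outside-ball x)) ⟩
    sumOver (allFin n) (λ x → 𝟙 (x ∈ˢ? S) * sumOver (allFin n) (far x))
      ≡⟨ sumOver-cong (allFin n) (λ x → sumOver-*ˡ (allFin n) (𝟙 (x ∈ˢ? S)) (far x)) ⟨
    sumOver (allFin n) (λ x → sumOver (allFin n) (λ y → 𝟙 (x ∈ˢ? S) * far x y))
      ≡⟨ sumOver-cong (allFin n) (λ x → sumOver-cong (allFin n) (λ y → 𝟙-hits es x y S)) ⟨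
    sumOver (allFin n) (λ x → sumOver (allFin n) (λ y → 𝟙 (hits? es (x , y) S)))
      ≡⟨ sumOver-cartesianProduct (allFin n) (allFin n) _ ⟨
    sumOver (cartesianProduct (allFin n) (allFin n)) (λ e → 𝟙 (hits? es e S))
      ∎
    where
    open ≤-Reasoning
    far : Fin n → Fin n → ℕ
    far x y = 𝟙 (y ∈ˢ? S) * 𝟙 (¬? (y ∈? ball es k x))

    outside-ball : ∀ x → h ≤ sumOver (allFin n) (far x)
    outside-ball x = +-cancelʳ-≤ h h _ (begin
      h + h                                                  ≡⟨ cong (h +_) (+-identityʳ h) ⟨
      2 * h                                                  ≤⟨ 2h≤∣S∣ ⟩
      ∣ S ∣                                                  ≤⟨ card-avoiding S (ball es k x) ⟩
      sumOver (allFin n) (far x) + length (ball es k x)      ≤⟨ +-monoʳ-≤ _ (≤-trans (length-ball es bounded k x) ball≤h) ⟩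
      sumOver (allFin n) (far x) + h                         ∎)

  -- Degrees and links only grow with the list, so no new bad sets arise.
  bad-∷ : ∀ {e es S} → Bad (e ∷ es) S → Bad es S
  bad-∷ {x , y} {es} (2h≤ , deg<D , indep) =
      2h≤
    , (λ z z∈S → ≤-<-trans (≤-trans (m≤n+m _ (𝟙 (z Fin.≟ y))) (≤-trans (m≤n+m _ (𝟙 (z Fin.≟ x)))
        (≤-reflexive (sym (deg-∷ x y es z))))) (deg<D z z∈S))
    , λ a b a∈S b∈S → indep a b a∈S b∈S ∘ there

  step : ∀ {es} → Bounded es → Sparse k es → 0 < #bad es →
    ∃[ e ] (Bounded (e ∷ es) × Sparse k (e ∷ es) × suc v * #bad (e ∷ es) ≤ v * #bad es)
  step {es} bounded sparse 0<bad
    with pigeonhole (cartesianProduct (allFin n) (allFin n)) (subsets n)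
           (λ e S → 𝟙 (hits? es e S)) (λ S → 𝟙 (bad? es S)) (2 * h * h) (suc v)
           {{m*n≢0 (2 * h) h {{m*n≢0 2 h}}}} pairs>0 pairs≤ many
    where
    #pairs : length (cartesianProduct (allFin n) (allFin n)) ≡ n * n
    #pairs = trans (length-cartesianProduct (allFin n) (allFin n))
      (cong₂ _*_ (length-tabulate {n = n} id) (length-tabulate {n = n} id))
    pairs>0 : 0 < length (cartesianProduct (allFin n) (allFin n))
    pairs>0 = subst (0 <_) (sym #pairs) (>-nonZero⁻¹ (n * n) {{m*n≢0 n n}})
    pairs≤ : length (cartesianProduct (allFin n) (allFin n)) ≤ suc v * (2 * h * h)
    pairs≤ = ≤-trans (≤-reflexive #pairs) n²≤
    many : ∀ S → 2 * h * h * 𝟙 (bad? es S) ≤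
      sumOver (cartesianProduct (allFin n) (allFin n)) (λ e → 𝟙 (hits? es e S)) * 𝟙 (bad? es S)
    many S = *-𝟙-mono (bad? es S) (many-hits bounded)
  ... | (x , y) , bad≤hits
    -- A bad set hit by the chosen pair certifies that both ends have degree below D and that they
    -- are far apart.
    with positive-term (subsets n) (λ S → 𝟙 (hits? es (x , y) S) * 𝟙 (bad? es S))
           (positive-factor (suc v) (<-≤-trans 0<bad bad≤hits))
  ... | S , 0<hit
    with 𝟙-witness (hits? es (x , y) S ×-dec bad? es S)
           (subst (0 <_) (sym (𝟙-× (hits? es (x , y) S) (bad? es S))) 0<hit)
  ... | (x∈S , y∈S , y∉ball) , (_ , deg<D , _)
    = (x , y) , bounded′ , sparse-∷ sparse (y∉ball ∘ ∈-ball es) , decrease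
    where
    open ≤-Reasoning
    hits : ℕ
    hits = sumOver (subsets n) (λ S → 𝟙 (hits? es (x , y) S) * 𝟙 (bad? es S))

    x≢y : x ≢ y
    x≢y refl = y∉ball (∈-ball es [])

    bounded′ : Bounded ((x , y) ∷ es)
    bounded′ z = ≤-trans (≤-reflexive (deg-∷ x y es z)) (bound (z Fin.≟ x) (z Fin.≟ y))
      where
      bound : (zx : Dec (z ≡ x)) (zy : Dec (z ≡ y)) → 𝟙 zx + (𝟙 zy + deg es z) ≤ suc D
      bound (yes refl) (yes refl) = contradiction refl x≢y
      bound (yes refl) (no _)     = m≤n⇒m≤1+n (deg<D x x∈S)
      bound (no _)     (yes refl) = m≤n⇒m≤1+n (deg<D y y∈S)
      bound (no _)     (no _)     = bounded z

    disjoint : ∀ S → 𝟙 (bad? ((x , y) ∷ es) S) + 𝟙 (hits? es (x , y) S) * 𝟙 (bad? es S) ≤ 𝟙 (bad? es S)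
    disjoint S = subst (λ t → 𝟙 (bad? ((x , y) ∷ es) S) + t ≤ 𝟙 (bad? es S))
      (𝟙-× (hits? es (x , y) S) (bad? es S))
      (𝟙-disjoint (bad? ((x , y) ∷ es) S) (hits? es (x , y) S ×-dec bad? es S) (bad? es S) bad-∷ proj₂
        λ (_ , _ , indep) ((x∈S , y∈S , _) , _) → indep x y x∈S y∈S (here (inj₁ (refl , refl))))

    decrease : suc v * #bad ((x , y) ∷ es) ≤ v * #bad es
    -- The sets hit and the sets still bad are disjoint families of formerly bad sets. Adding
    -- `#bad es` to both sides turns the right side into `suc v * #bad es`.
    decrease = +-cancelˡ-≤ (#bad es) _ _ (begin
      #bad es + suc v * #bad ((x , y) ∷ es)            ≤⟨ +-monoˡ-≤ _ bad≤hits ⟩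
      suc v * hits + suc v * #bad ((x , y) ∷ es)       ≡⟨ *-distribˡ-+ (suc v) hits _ ⟨
      suc v * (hits + #bad ((x , y) ∷ es))             ≡⟨ cong (suc v *_) (+-comm hits _) ⟩
      suc v * (#bad ((x , y) ∷ es) + hits)             ≡⟨ cong (suc v *_) (sumOver-+ (subsets n) _ _) ⟨
      suc v * sumOver (subsets n) (λ S → 𝟙 (bad? ((x , y) ∷ es) S) + 𝟙 (hits? es (x , y) S) * 𝟙 (bad? es S))
                                                       ≤⟨ *-monoʳ-≤ (suc v) (sumOver-mono (subsets n) disjoint) ⟩
      suc v * #bad es                                  ∎)

  -- The list may be shorter than t: once no bad set is left, it stays as it is.
  Reached : ℕ → Set
  Reached t = ∃[ es ] (length es ≤ t × Bounded es × Sparse k es × suc v ^ t * #bad es ≤ v ^ t * #bad [])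

  advance : ∀ {t} → Reached t → Reached (suc t)
  advance {t} (es , ∣es∣≤t , bounded , sparse , small) = continue (#bad es ≟ 0)
    where
    continue : Dec (#bad es ≡ 0) → Reached (suc t)
    continue (yes none) = es , m≤n⇒m≤1+n ∣es∣≤t , bounded , sparse ,
      ≤-trans (≤-reflexive (trans (cong (suc v ^ suc t *_) none) (*-zeroʳ (suc v ^ suc t)))) z≤n
    continue (no some) =
      let e , bounded′ , sparse′ , decrease = step {es} bounded sparse (n≢0⇒n>0 some)
      in e ∷ es , s≤s ∣es∣≤t , bounded′ , sparse′ , 
        geometric-step {suc v} {v} {#bad []} {#bad es} {V = v ^ t} {suc v ^ t} decrease small

  iterate : ∀ t → Reached t
  iterate zero    = [] , z≤n , (λ _ → z≤n) , (λ ()) , ≤-refl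
  iterate (suc t) = advance (iterate t)

  #bad≤ : ∀ es → #bad es ≤ 2 ^ n
  #bad≤ es = ≤-trans (sumOver-mono (subsets n) (λ S → 𝟙≤1 (bad? es S)))
    (≤-reflexive (trans (sumOver-const (subsets n) 1) (trans (*-identityʳ _) (length-subsets n))))

  -- Every `suc v` steps at least halve the number of bad sets, and n + 1 halvings bring 2^n below
  -- 1.
  exhaust : ∃[ es ] (length es ≤ suc v * suc n × Sparse k es × ∀ S → ¬ Bad es S)
  exhaust with iterate (suc v * suc n)
  ... | es , ∣es∣≤ , _ , sparse , small = es , ∣es∣≤ , sparse , λ S bad →
    <-irrefl refl (begin-strict
      -- Strictness comes from `suc v ^ t` being positive, so the case v = 0, where `v ^ t`
      -- vanishes, is covered too. The halving beyond the first n pays for the doubled term.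
      v ^ t * 2 ^ n                    <⟨ m<n+m (v ^ t * 2 ^ n) (m^n>0 (suc v) t) ⟩
      suc v ^ t + v ^ t * 2 ^ n        ≤⟨ +-monoˡ-≤ (v ^ t * 2 ^ n) (few bad) ⟩
      v ^ t * 2 ^ n + v ^ t * 2 ^ n    ≡⟨ double (v ^ t) (2 ^ n) ⟩
      2 * 2 ^ n * v ^ t                ≤⟨ repeated-halving v (suc n) ⟩
      suc v ^ t                        ≤⟨ few bad ⟩
      v ^ t * 2 ^ n                    ∎)
    where
    open ≤-Reasoning
    t = suc v * suc n

    double : ∀ a b → a * b + a * b ≡ 2 * b * a
    double = solve-∀

    few : ∀ {S} → Bad es S → suc v ^ t ≤ v ^ t * 2 ^ n
    few {S} bad = begin
      suc v ^ t                      ≡⟨ *-identityʳ _ ⟨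
      suc v ^ t * 1                  ≤⟨ *-monoʳ-≤ (suc v ^ t) (subst (_≤ #bad es) (𝟙-yes (bad? es S) bad)
                                          (term≤sumOver (λ S → 𝟙 (bad? es S)) (∈-subsets S))) ⟩
      suc v ^ t * #bad es            ≤⟨ small ⟩
      v ^ t * #bad []                ≤⟨ *-monoʳ-≤ (v ^ t) (#bad≤ []) ⟩
      v ^ t * 2 ^ n                  ∎

-- Cycles, girth and degrees

does-witness : {P : Set} (P? : Dec P) → T (does P?) → P
does-witness (yes p) _ = p

witness-does : {P : Set} (P? : Dec P) → P → T (does P?)
witness-does (yes _) p = _
witness-does (no ¬p) p = ¬p p

-- P is asked only of the start of each step, because a cycle closes up at a vertex where P fails.
linked-walk : ∀ {P : A → Set} {m p z} (ps : Vec A m) →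
  (∀ {a b} → P a → R a b → R′ a b) → VecAll.All P (p ∷ ps) → Linked R (p ∷ (ps ∷ʳ z)) →
  Walk R′ (suc m) p z
linked-walk []       step (Pp VecAll.∷ _)   (r ∷ [-]) = step Pp r ∷ []
linked-walk (q ∷ ps) step (Pp VecAll.∷ Pps) (r ∷ rs)  = step Pp r ∷ linked-walk ps step Pps rs

-- Without its first edge xy, the cycle is a walk of length j - 1 from y to x. It avoids xy: its
-- first step leads to z, and every later step starts at a vertex other than x and y. Sparseness
-- then forces j - 1 > k.
cycle-length : ∀ {es : List (Edge n)} {G : Graph n} {j} → Sparse k es →
  (∀ {u v} → Adj G u v → Link es u v) → HasCycle G j → 2 + k ≤ j
cycle-length sparse G⊆es (_ ∷ []     , s≤s ()       , _)
cycle-length sparse G⊆es (_ ∷ _ ∷ [] , s≤s (s≤s ()) , _)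
cycle-length {k = k} {es} {G} {j} sparse G⊆es
  (x ∷ y ∷ z ∷ vs , _ ,
   (_ VecAll.∷ x≢z VecAll.∷ x∉vs) ∷ (y≢z VecAll.∷ y∉vs) ∷ _ , xy ∷ yz ∷ zs) =
  decidable-stable (2 + k ≤? j) λ short →
    sparse (link-sym (G⊆es xy)) (walk-mono (≤-pred (≤-pred (≰⇒> short)))
      ((G⊆es yz , λ { (inj₁ (_ , z≡x)) → x≢z (sym z≡x) ; (inj₂ (_ , z≡y)) → y≢z (sym z≡y) })
        ∷ linked-walk vs avoid (VecAll.zip ((x≢z VecAll.∷ x∉vs) , (y≢z VecAll.∷ y∉vs))) zs))
  where
  avoid : ∀ {a b} → x ≢ a × y ≢ a → Adj G a b → Avoiding es (y , x) a b
  avoid (x≢a , y≢a) ab = G⊆es ab ,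
    λ { (inj₁ (a≡y , _)) → y≢a (sym a≡y) ; (inj₂ (a≡x , _)) → x≢a (sym a≡x) }

girth-bound : ∀ {r} {G : Graph n} → (∀ {j} → HasCycle G j → r ≤ j) → [ r ] ≤⁺ girth G
girth-bound {n} {r} {G} r≤ = head-bound (all-filter (hasCycle? G) (upTo (suc n)))
  where
  head-bound : ∀ {js} → All (HasCycle G) js → [ r ] ≤⁺ head js
  head-bound []      = _ ≤⊤⁺
  head-bound (c ∷ _) = [ r≤ c ]

∅ : EdgeSet n
∅ = record { adj = λ _ _ → false ; symm = λ _ _ → refl ; irrefl = λ _ → refl }

Δ-∅ : (Y : Graph n) (∅⊆E : ∅ ⊆E E Y) → Δ (spanning Y ∅ ∅⊆E) ≤ 1
Δ-∅ {n} Y ∅⊆E = max≤v⁺ z≤n (map⁺ (universal (λ _ → ≤-trans (≤-reflexive (card-∅ n)) z≤n) (allFin n)))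
  where
  card-∅ : ∀ m → ∣ Vec.tabulate {n = m} (λ _ → false) ∣ ≡ 0
  card-∅ zero    = refl
  card-∅ (suc m) = card-∅ m

-- Fractional colourings

∑-cong : {f g : Subset n → ℚ} → (∀ S → f S ≡ g S) → ∑ f ≡ ∑ g
∑-cong {zero}  f≡g = f≡g []
∑-cong {suc n} f≡g = cong₂ ℚ._+_ (∑-cong (f≡g ∘ (inside ∷_))) (∑-cong (f≡g ∘ (outside ∷_)))

∑-+ : (f g : Subset n → ℚ) → ∑ (λ S → f S ℚ.+ g S) ≡ ∑ f ℚ.+ ∑ g
∑-+ {zero}  f g = refl
∑-+ {suc n} f g = trans
  (cong₂ ℚ._+_ (∑-+ (f ∘ (inside ∷_)) (g ∘ (inside ∷_))) (∑-+ (f ∘ (outside ∷_)) (g ∘ (outside ∷_))))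
  (+ℚ.interchange (∑ (f ∘ (inside ∷_))) (∑ (g ∘ (inside ∷_))) (∑ (f ∘ (outside ∷_))) (∑ (g ∘ (outside ∷_))))

∑-*ˡ : ∀ a (f : Subset n → ℚ) → ∑ (λ S → a ℚ.* f S) ≡ a ℚ.* ∑ f
∑-*ˡ {zero}  a f = refl
∑-*ˡ {suc n} a f = trans
  (cong₂ ℚ._+_ (∑-*ˡ a (f ∘ (inside ∷_))) (∑-*ˡ a (f ∘ (outside ∷_))))
  (sym (ℚ.*-distribˡ-+ a (∑ (f ∘ (inside ∷_))) (∑ (f ∘ (outside ∷_)))))

fromℕ-+ : ∀ a b → fromℕ (a + b) ≡ fromℕ a ℚ.+ fromℕ b
fromℕ-+ a b = ℚ.toℚᵘ-injective (begin-equality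
  ℚ.toℚᵘ (fromℕ (a + b))                         ≃⟨ toℚᵘ-fromℕ (a + b) ⟩
  mkℚᵘ (ℤ.+ (a + b)) 0                              ≃⟨ ℚᵘ.*≡* (cong (ℤ._* ℤ.+ 1)
    (trans (ℤ.pos-+ a b) (sym (cong₂ ℤ._+_ (ℤ.*-identityʳ (ℤ.+ a)) (ℤ.*-identityʳ (ℤ.+ b)))))) ⟩
  mkℚᵘ (ℤ.+ a) 0 ℚᵘ.+ mkℚᵘ (ℤ.+ b) 0                  ≃⟨ ℚᵘ.+-cong (toℚᵘ-fromℕ a) (toℚᵘ-fromℕ b) ⟨
  ℚ.toℚᵘ (fromℕ a) ℚᵘ.+ ℚ.toℚᵘ (fromℕ b)         ≃⟨ ℚ.toℚᵘ-homo-+ (fromℕ a) (fromℕ b) ⟨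
  ℚ.toℚᵘ (fromℕ a ℚ.+ fromℕ b)                   ∎)
  where open ℚᵘ.≤-Reasoning

module _ {Y : Graph n} (c : FractionalColouring Y) where
  open FractionalColouring c hiding (total)

  -- Sum the covering constraints over vs: each set is then counted with the number of entries of vs
  -- that it contains.
  coverage : ∀ (vs : List (Fin n)) → All (_∈ˢ V Y) vs →
    fromℕ (length vs) ℚ.≤ ∑ (λ S → fromℕ (sumOver vs (λ v → 𝟙 (v ∈ˢ? S))) ℚ.* weight S)
  coverage []       []           = ∑-nonneg (λ S → 0≤* ℚ.≤-refl (weight≥0 S))
  coverage (v ∷ vs) (v∈V ∷ vs⊆V) = begin
    fromℕ (suc (length vs))                    ≡⟨ fromℕ-+ 1 (length vs) ⟩
    1ℚ ℚ.+ fromℕ (length vs)                   ≤⟨ ℚ.+-mono-≤ (covers v v∈V) (coverage vs vs⊆V) ⟩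
    ∑ (λ S → if does (v ∈ˢ? S) then weight S else 0ℚ) ℚ.+
      ∑ (λ S → fromℕ (sumOver vs (λ v → 𝟙 (v ∈ˢ? S))) ℚ.* weight S)
                                               ≡⟨ ∑-+ (λ S → if does (v ∈ˢ? S) then weight S else 0ℚ) _ ⟨
    ∑ (λ S → (if does (v ∈ˢ? S) then weight S else 0ℚ) ℚ.+
      fromℕ (sumOver vs (λ v → 𝟙 (v ∈ˢ? S))) ℚ.* weight S)
                                               ≡⟨ ∑-cong merge ⟩
    ∑ (λ S → fromℕ (sumOver (v ∷ vs) (λ v → 𝟙 (v ∈ˢ? S))) ℚ.* weight S) ∎
    where
    open ℚ.≤-Reasoning
    indicator : ∀ S → (if does (v ∈ˢ? S) then weight S else 0ℚ) ≡ fromℕ (𝟙 (v ∈ˢ? S)) ℚ.* weight S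
    indicator S with v ∈ˢ? S
    ... | yes _ = sym (ℚ.*-identityˡ (weight S))
    ... | no _  = sym (ℚ.*-zeroˡ (weight S))
    merge : ∀ S → (if does (v ∈ˢ? S) then weight S else 0ℚ) ℚ.+
        fromℕ (sumOver vs (λ v → 𝟙 (v ∈ˢ? S))) ℚ.* weight S ≡
      fromℕ (sumOver (v ∷ vs) (λ v → 𝟙 (v ∈ˢ? S))) ℚ.* weight S
    merge S = trans (cong (ℚ._+ fromℕ m ℚ.* weight S) (indicator S))
      (trans (sym (ℚ.*-distribʳ-+ (weight S) (fromℕ (𝟙 (v ∈ˢ? S))) (fromℕ m)))
             (cong (ℚ._* weight S) (sym (fromℕ-+ (𝟙 (v ∈ˢ? S)) m))))
      where m = sumOver vs (λ v → 𝟙 (v ∈ˢ? S))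

  -- The standard bound |V|/α ≤ χᶠ, free of division. Dependent sets have weight 0, so bounding the
  -- independent ones suffices.
  vertices≤α*total : ∀ {α} (vs : List (Fin n)) → All (_∈ˢ V Y) vs →
    (∀ S → Independent Y S → sumOver vs (λ v → 𝟙 (v ∈ˢ? S)) ≤ α) →
    fromℕ (length vs) ℚ.≤ fromℕ α ℚ.* total c
  vertices≤α*total {α} vs vs⊆V ≤α = begin
    fromℕ (length vs)                     ≤⟨ coverage vs vs⊆V ⟩
    ∑ (λ S → fromℕ (sumOver vs (λ v → 𝟙 (v ∈ˢ? S))) ℚ.* weight S)
                                          ≤⟨ ∑-mono bound ⟩
    ∑ (λ S → fromℕ α ℚ.* weight S)        ≡⟨ ∑-*ˡ (fromℕ α) weight ⟩
    fromℕ α ℚ.* total c                   ∎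
    where
    open ℚ.≤-Reasoning
    bound : ∀ S → fromℕ (sumOver vs (λ v → 𝟙 (v ∈ˢ? S))) ℚ.* weight S ℚ.≤ fromℕ α ℚ.* weight S
    bound S with independent? Y S
    ... | yes indep = ℚ.*-monoʳ-≤-nonNeg (weight S) {{ℚ.nonNegative (weight≥0 S)}} (fromℕ-mono (≤α S indep))
    ... | no dep    = ℚ.≤-reflexive (trans (vanish (fromℕ (sumOver vs (λ v → 𝟙 (v ∈ˢ? S))))) (sym (vanish (fromℕ α))))
      where
      vanish : ∀ a → a ℚ.* weight S ≡ 0ℚ
      vanish a = trans (cong (a ℚ.*_) (support S dep)) (ℚ.*-zeroʳ a)

-- The graph on the vertices of low degree

sumOver-filter : ∀ {P : A → Set} (P? : Decidable P) (xs : List A) f → sumOver (filter P? xs) f ≤ sumOver xs f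
sumOver-filter P? []       f = z≤n
sumOver-filter P? (x ∷ xs) f with P? x
... | yes _ = +-monoʳ-≤ (f x) (sumOver-filter P? xs f)
... | no _  = ≤-trans (sumOver-filter P? xs f) (m≤n+m _ (f x))

length-filter≡ : ∀ {P : A → Set} (P? : Decidable P) (xs : List A) →
  length (filter P? xs) ≡ sumOver xs (λ x → 𝟙 (P? x))
length-filter≡ P? []       = refl
length-filter≡ P? (x ∷ xs) with P? x
... | yes _ = cong suc (length-filter≡ P? xs)
... | no _  = length-filter≡ P? xs

module LowDegree (D : ℕ) (es : List (Edge n)) (irreflexive : ∀ {x} → ¬ Link es x x) where

  Low : Fin n → Set
  Low x = deg es x < D

  low? : ∀ x → Dec (Low x)
  low? x = deg es x <? D

  LowLink : Fin n → Fin n → Set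
  LowLink x y = Low x × Low y × Link es x y

  lowLink? : ∀ x y → Dec (LowLink x y)
  lowLink? x y = low? x ×-dec low? y ×-dec link? es x y

  lowVertices : Subset n
  lowVertices = Vec.tabulate (does ∘ low?)

  ∈-lowVertices : ∀ {x} → Low x → x ∈ˢ lowVertices
  ∈-lowVertices {x} low = lookup⇒[]= x lowVertices
    (trans (lookup∘tabulate (does ∘ low?) x) (dec-true (low? x) low))

  lowVertices-low : ∀ {x} → x ∈ˢ lowVertices → Low x
  lowVertices-low {x} x∈ = does-witness (low? x)
    (subst T (trans (sym ([]=⇒lookup x∈)) (lookup∘tabulate (does ∘ low?) x)) _)

  graph : Graph n
  graph = record
    { V         = lowVertices
    ; E         = record
      { adj    = λ x y → does (lowLink? x y)
      ; symm   = λ x y → does-≡ (map′ flip flip (lowLink? x y)) (lowLink? y x)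
      ; irrefl = λ x → dec-false (lowLink? x x) λ (_ , _ , l) → irreflexive l
      }
    ; endpoints = λ {x} {y} xy → ∈-lowVertices (proj₁ (does-witness (lowLink? x y) xy))
    }
    where
    flip : ∀ {x y} → LowLink x y → LowLink y x
    flip (low-x , low-y , l) = low-y , low-x , link-sym l

  adj⇒link : ∀ {x y} → Adj graph x y → Link es x y
  adj⇒link {x} {y} = proj₂ ∘ proj₂ ∘ does-witness (lowLink? x y)

  link⇒adj : ∀ {x y} → x ∈ˢ lowVertices → y ∈ˢ lowVertices → Link es x y → Adj graph x y
  link⇒adj {x} {y} x∈ y∈ l = witness-does (lowLink? x y) (lowVertices-low x∈ , lowVertices-low y∈ , l)

  low : List (Fin n)
  low = filter low? (allFin n)

  low⊆V : All (_∈ˢ lowVertices) low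
  low⊆V = All.map ∈-lowVertices (all-filter low? (allFin n))

  -- Markov's inequality: the degrees add up to at most 2 |es| ≤ D n / 2, and every vertex that is
  -- not low contributes at least D.
  many-low : .{{_ : NonZero D}} → 4 * length es ≤ D * n → n ≤ 2 * length low
  many-low few-edges = +-cancelʳ-≤ n n (2 * length low) (begin
    n + n                                  ≡⟨ cong (n +_) (+-identityʳ n) ⟨
    2 * n                                  ≤⟨ *-monoʳ-≤ 2 cover ⟩
    2 * (length low + high)                ≡⟨ *-distribˡ-+ 2 (length low) high ⟩
    2 * length low + 2 * high              ≤⟨ +-monoʳ-≤ (2 * length low) (*-cancelˡ-≤ D few-high) ⟩
    2 * length low + n                     ∎)
    where
    open ≤-Reasoning
    high : ℕ
    high = sumOver (allFin n) (λ x → 𝟙 (¬? (low? x)))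

    cover : n ≤ length low + high
    cover = begin
      n                                    ≡⟨ trans (*-identityʳ (length (allFin n))) (length-tabulate {n = n} id) ⟨
      length (allFin n) * 1                ≡⟨ sumOver-const (allFin n) 1 ⟨
      sumOver (allFin n) (λ _ → 1)         ≤⟨ sumOver-mono (allFin n) (λ x → excluded-middle (low? x)) ⟩
      sumOver (allFin n) (λ x → 𝟙 (low? x) + 𝟙 (¬? (low? x)))
                                           ≡⟨ sumOver-+ (allFin n) (λ x → 𝟙 (low? x)) _ ⟩
      sumOver (allFin n) (λ x → 𝟙 (low? x)) + high
                                           ≡⟨ cong (_+ high) (length-filter≡ low? (allFin n)) ⟨
      length low + high                    ∎
      where
      excluded-middle : {P : Set} (P? : Dec P) → 1 ≤ 𝟙 P? + 𝟙 (¬? P?)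
      excluded-middle (yes _) = ≤-refl
      excluded-middle (no _)  = ≤-refl

    weight≤deg : ∀ x → D * 𝟙 (¬? (low? x)) ≤ deg es x
    weight≤deg x = case-low (low? x)
      where
      case-low : (l? : Dec (Low x)) → D * 𝟙 (¬? l?) ≤ deg es x
      case-low (yes _) = ≤-trans (≤-reflexive (*-zeroʳ D)) z≤n
      case-low (no ¬l) = ≤-trans (≤-reflexive (*-identityʳ D)) (≮⇒≥ ¬l)

    few-high : D * (2 * high) ≤ D * n
    few-high = begin
      D * (2 * high)                       ≡⟨ swap-factors D high ⟩
      2 * (D * high)                       ≡⟨ cong (2 *_) (sumOver-*ˡ (allFin n) D _) ⟨
      2 * sumOver (allFin n) (λ x → D * 𝟙 (¬? (low? x)))
                                           ≤⟨ *-monoʳ-≤ 2 (sumOver-mono (allFin n) weight≤deg) ⟩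
      2 * sumOver (allFin n) (deg es)      ≤⟨ *-monoʳ-≤ 2 (sum-deg es) ⟩
      2 * (2 * length es)                  ≡⟨ *-assoc 2 2 (length es) ⟨
      4 * length es                        ≤⟨ few-edges ⟩
      D * n                                ∎
      where
      swap-factors : ∀ a b → a * (2 * b) ≡ 2 * (a * b)
      swap-factors = solve-∀

-- Graphs of large girth without large independent sets

-- Quantifying over all H with edges in Y lets one proof serve both Y and `Y ─ ∅`.
HighGirth : ℕ → Graph n → Set
HighGirth r Y = ∀ {H j} → (∀ {u v} → Adj H u v → Adj Y u v) → HasCycle H j → r ≤ j

large-girth-graph : ∀ n x k .{{_ : NonZero n}} .{{_ : NonZero x}} → (10 * (x * x)) ^ k * x ≤ n →
  ∃[ Y ] (HighGirth {n} (2 + k) Y × ∀ c → fromℕ x ℚ.≤ fromℕ 8 ℚ.* total {G = Y} c)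
large-girth-graph n x@(suc x-1) k small = graph , high-girth , bound
  where
  -- The greedy run makes at most x² (n + 1) steps, so at most half of the vertices
  -- reach the degree D; every independent set of the others has fewer than 2h ≈ 2n/x
  -- elements.
  h D : ℕ
  h = suc (n / x)
  D = 8 * (x * x)

  instance
    D≢0 : NonZero D
    D≢0 = m*n≢0 8 (x * x)

  x≤n : x ≤ n
  x≤n = ≤-trans (m≤n*m x ((10 * (x * x)) ^ k) {{m^n≢0 (10 * (x * x)) k}}) small

  n≤hx : n ≤ h * x
  n≤hx = ≤-trans (≤-reflexive (m≡m%n+[m/n]*n n x)) (+-monoˡ-≤ (n / x * x) (<⇒≤ (m%n<n n x)))

  hx≤2n : h * x ≤ 2 * n
  hx≤2n = +-mono-≤ x≤n (≤-trans (m/n*n≤m n x) (≤-reflexive (sym (+-identityʳ n))))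

  ball≤h : suc (suc D) ^ k ≤ h
  ball≤h = *-cancelʳ-≤ (suc (suc D) ^ k) h x (begin
    suc (suc D) ^ k * x              ≤⟨ *-monoˡ-≤ x (^-monoˡ-≤ k degrees) ⟩
    (10 * (x * x)) ^ k * x           ≤⟨ small ⟩
    n                                ≤⟨ n≤hx ⟩
    h * x                            ∎)
    where
    open ≤-Reasoning
    -- As x ≥ 1, the 2 is absorbed into 2x²; hence the constant 10 = 8 + 2.
    degrees : 2 + D ≤ 10 * (x * x)
    degrees = ≤-trans (+-monoˡ-≤ D (*-monoʳ-≤ 2 (>-nonZero⁻¹ (x * x))))
      (≤-reflexive (sym (*-distribʳ-+ (x * x) 2 8)))

  n²≤ : n * n ≤ x * x * (2 * h * h)
  n²≤ = begin
    n * n                            ≤⟨ ℕ.*-mono-≤ n≤hx n≤hx ⟩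
    h * x * (h * x)                  ≤⟨ m≤m+n _ _ ⟩
    h * x * (h * x) + h * x * (h * x) ≡⟨ regroup h x ⟩
    x * x * (2 * h * h)              ∎
    where
    open ≤-Reasoning
    regroup : ∀ h x → h * x * (h * x) + h * x * (h * x) ≡ x * x * (2 * h * h)
    regroup = solve-∀

  -- `x-1 + x-1 * x` is x² - 1, so `suc v` computes to `x * x`.
  open Greedy n k D h (x-1 + x-1 * x) ball≤h n²≤

  es : List (Edge n)
  es = proj₁ exhaust

  sparse : Sparse k es
  sparse = proj₁ (proj₂ (proj₂ exhaust))

  -- A loop would have its ends joined by the empty walk.
  open LowDegree D es (λ l → sparse l [])

  high-girth : HighGirth (2 + k) graph
  high-girth H⊆graph = cycle-length sparse (adj⇒link ∘ H⊆graph)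

  few-edges : 4 * length es ≤ D * n
  few-edges = begin
    4 * length es                    ≤⟨ *-monoʳ-≤ 4 (proj₁ (proj₂ exhaust)) ⟩
    -- Here n + 1 ≤ 2n produces the factor 8 in D.
    4 * (x * x * suc n)              ≤⟨ *-monoʳ-≤ 4 (*-monoʳ-≤ (x * x) (+-monoˡ-≤ n (>-nonZero⁻¹ n))) ⟩
    4 * (x * x * (n + n))            ≡⟨ regroup x n ⟩
    D * n                            ∎
    where
    open ≤-Reasoning
    regroup : ∀ x n → 4 * (x * x * (n + n)) ≡ 8 * (x * x) * n
    regroup = solve-∀

  small-independent : ∀ S → Independent graph S → sumOver low (λ v → 𝟙 (v ∈ˢ? S)) ≤ 2 * h
  small-independent S (S⊆V , indep) = begin
    sumOver low (λ v → 𝟙 (v ∈ˢ? S))           ≤⟨ sumOver-filter low? (allFin n) _ ⟩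
    sumOver (allFin n) (λ v → 𝟙 (v ∈ˢ? S))    ≡⟨ card≡sumOver S ⟩
    ∣ S ∣                                     ≤⟨ <⇒≤ (≰⇒> λ large → proj₂ (proj₂ (proj₂ exhaust)) S
      (large , (λ x x∈S → lowVertices-low (S⊆V x∈S)) ,
       λ x y x∈S y∈S l → indep x y x∈S y∈S (link⇒adj (S⊆V x∈S) (S⊆V y∈S) l))) ⟩
    2 * h                                     ∎
    where open ≤-Reasoning

  bound : (c : FractionalColouring graph) → fromℕ x ℚ.≤ fromℕ 8 ℚ.* total c
  -- Combines n ≤ 2 |low|, |low| ≤ 2h χ for the total weight χ, and h x ≤ 2n into n x ≤ 4 h x χ ≤ 8
  -- n χ.
  bound c = ℚ.*-cancelˡ-≤-pos (fromℕ n) {{ℚ.normalize-pos n 1}} (begin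
    fromℕ n ℚ.* fromℕ x                              ≡⟨ fromℕ-* n x ⟨
    fromℕ (n * x)                                    ≤⟨ fromℕ-mono (≤-trans (*-monoˡ-≤ x (many-low few-edges)) (≤-reflexive (commute (length low) x))) ⟩
    fromℕ (2 * x * length low)                       ≡⟨ fromℕ-* (2 * x) (length low) ⟩
    fromℕ (2 * x) ℚ.* fromℕ (length low)             ≤⟨ ℚ.*-monoˡ-≤-nonNeg (fromℕ (2 * x)) {{ℚ.nonNegative (0≤fromℕ (2 * x))}}
                                                          (vertices≤α*total c low low⊆V small-independent) ⟩
    fromℕ (2 * x) ℚ.* (fromℕ (2 * h) ℚ.* total c)    ≡⟨ collect (2 * x) (2 * h) ⟩
    fromℕ (2 * x * (2 * h)) ℚ.* total c              ≤⟨ ℚ.*-monoʳ-≤-nonNeg (total c)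
                                                          {{ℚ.nonNegative (∑-nonneg (FractionalColouring.weight≥0 c))}}
                                                          (fromℕ-mono product≤8n) ⟩
    fromℕ (n * 8) ℚ.* total c                        ≡⟨ collect n 8 ⟨
    fromℕ n ℚ.* (fromℕ 8 ℚ.* total c)                ∎)
    where
    open ℚ.≤-Reasoning
    commute : ∀ l x → 2 * l * x ≡ 2 * x * l
    commute = solve-∀
    collect : ∀ a b → fromℕ a ℚ.* (fromℕ b ℚ.* total c) ≡ fromℕ (a * b) ℚ.* total c
    collect a b = trans (sym (ℚ.*-assoc (fromℕ a) (fromℕ b) (total c))) (cong (ℚ._* total c) (sym (fromℕ-* a b)))
    product≤8n : 2 * x * (2 * h) ≤ n * 8
    product≤8n = ≤-trans (≤-reflexive (regroup x h)) (≤-trans (*-monoʳ-≤ 4 hx≤2n) (≤-reflexive (regroup′ n)))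
      where
      regroup : ∀ x h → 2 * x * (2 * h) ≡ 4 * (h * x)
      regroup = solve-∀
      regroup′ : ∀ n → 4 * (2 * n) ≡ n * 8
      regroup′ = solve-∀

⊆K : (Y : Graph n) → Y ⊆G K n
⊆K {n} Y = (λ _ → ∈⊤) , λ {u} {v} → distinct u v
  where
  distinct : ∀ u v → Adj Y u v → Adj (K n) u v
  distinct u v uv with u Fin.≟ v
  ... | yes refl = subst T (EdgeSet.irrefl (E Y) u) uv
  ... | no _     = _

-- Choice of x in terms of n

last-true : ∀ {P : ℕ → Set} → Decidable P → P 1 → ∀ j → ¬ P (suc j) →
  ∃[ x ] (NonZero x × P x × ¬ P (suc x))
last-true P? P1 zero    ¬P = contradiction P1 ¬P
last-true P? P1 (suc j) ¬P with P? (suc j)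
... | yes p = suc j , _ , p , ¬P
... | no ¬p = last-true P? P1 j ¬p

m≤m^[1+n] : ∀ m n .{{_ : NonZero m}} → m ≤ m ^ suc n
m≤m^[1+n] m n = m≤m*n m (m ^ n) {{m^n≢0 m n}}

-- Take x with 10^k x^(2(k+1)) ≤ n while x + 1 fails this, so that x has the order of
-- n^(1/(2(k+1))). The upper bound follows from x + 1 ≤ 2x, with 10^k enlarged to its own power.
scale : ∀ k n → 10 ^ k ≤ n → ∃[ x ] (NonZero x × (10 * (x * x)) ^ k * x ≤ n ×
  n ≤ (10 ^ k * (2 * x)) ^ (2 * suc k))
scale k n 10^k≤n with last-true (λ x → 10 ^ k * x ^ (2 * suc k) ≤? n) at-1 n at-1+n
  where
  at-1 : 10 ^ k * 1 ^ (2 * suc k) ≤ n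
  at-1 = ≤-trans (≤-reflexive (trans (cong (10 ^ k *_) (^-zeroˡ (2 * suc k))) (*-identityʳ (10 ^ k)))) 10^k≤n
  at-1+n : ¬ (10 ^ k * suc n ^ (2 * suc k) ≤ n)
  -- `suc (k + suc (k + 0))` is `2 * suc k` by computation.
  at-1+n ≤n = <-irrefl refl (≤-trans (m≤m^[1+n] (suc n) (k + suc (k + 0)))
    (≤-trans (m≤n*m _ (10 ^ k) {{m^n≢0 10 k}}) ≤n))
... | x , x≢0 , below , ¬above = x , x≢0 , lower , upper
  where
  open ≤-Reasoning
  instance
    _ = x≢0
    _ = m^n≢0 10 k

  lower : (10 * (x * x)) ^ k * x ≤ n
  lower = begin
    (10 * (x * x)) ^ k * x               ≡⟨ cong (_* x) (^-distribʳ-* k 10 (x * x)) ⟩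
    -- Giving away a factor x raises the exponent 2k + 1 to 2(k + 1), that is 2(r - 1).
    10 ^ k * (x * x) ^ k * x             ≤⟨ *-monoʳ-≤ (10 ^ k * (x * x) ^ k) (m≤m*n x x) ⟩
    10 ^ k * (x * x) ^ k * (x * x)       ≡⟨ regroup (10 ^ k) ((x * x) ^ k) (x * x) ⟩
    10 ^ k * (x * x) ^ suc k             ≡⟨ cong (λ y → 10 ^ k * (x * y) ^ suc k) (*-identityʳ x) ⟨
    10 ^ k * (x ^ 2) ^ suc k             ≡⟨ cong (10 ^ k *_) (^-*-assoc x 2 (suc k)) ⟩
    10 ^ k * x ^ (2 * suc k)             ≤⟨ below ⟩
    n                                    ∎
    where
    regroup : ∀ a b c → a * b * c ≡ a * (c * b)
    regroup = solve-∀

  upper : n ≤ (10 ^ k * (2 * x)) ^ (2 * suc k)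
  upper = begin
    n                                          ≤⟨ <⇒≤ (≰⇒> ¬above) ⟩
    10 ^ k * suc x ^ (2 * suc k)               ≤⟨ ℕ.*-mono-≤ (m≤m^[1+n] (10 ^ k) (k + suc (k + 0)))
                                                    (^-monoˡ-≤ (2 * suc k) 1+x≤2x) ⟩
    (10 ^ k) ^ (2 * suc k) * (2 * x) ^ (2 * suc k)
                                               ≡⟨ ^-distribʳ-* (2 * suc k) (10 ^ k) (2 * x) ⟨
    (10 ^ k * (2 * x)) ^ (2 * suc k)           ∎
    where
    1+x≤2x : suc x ≤ 2 * x
    1+x≤2x = +-mono-≤ (>-nonZero⁻¹ x) (≤-reflexive (sym (+-identityʳ x)))

-- Real bounds

-- Clears denominators in a / b ≤ 1/d, so that `root-bound` can compare exponents as natural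
-- numbers.
numerator-bound : ∀ e m → 0ℚ ℚ.≤ e → e ℚ.≤ ℤ.+ 1 ℚ./ suc m → suc m * ℤ.∣ ℚ.↥ e ∣ ≤ ℚ.↧ₙ e
numerator-bound e@(ℚ.mkℚ ℤ.-[1+ _ ] _ _) m 0≤e _ = 
  contradiction (ℚ.<-≤-trans (ℚ.negative⁻¹ e) 0≤e) (ℚ.<-irrefl refl)
numerator-bound e@(ℚ.mkℚ (ℤ.+ a) b-1 _) m _ e≤ = ℤ.drop‿+≤+ (subst₂ ℤ._≤_
  (trans (sym (ℤ.pos-* a (suc m))) (cong ℤ.+_ (*-comm a (suc m)))) (ℤ.*-identityˡ (ℤ.+ suc b-1))
  (ℚᵘ.drop-*≤* (ℚᵘ.≤-respʳ-≃ (ℚ.toℚᵘ-fromℚᵘ (mkℚᵘ (ℤ.+ 1) m)) (ℚ.toℚᵘ-mono-≤ e≤))))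

-- In effect s ≤ n^(a/b) ≤ n^(1/d) ≤ Z; a larger s would give s^b > Z^b ≥ Z^(da) ≥ n^a.
root-bound : ∀ {n a b Z d s} .{{_ : NonZero Z}} → n ≤ Z ^ d → d * a ≤ suc b →
  s ^ℚ suc b ℚ.≤ fromℕ (n ^ a) → s ℚ.≤ fromℕ Z
root-bound {n} {a} {b} {Z} {d} {s} n≤Z^d da≤b s^b≤n^a = ℚ.≮⇒≥ λ Z<s → ℚ.<-irrefl refl (begin-strict
  fromℕ Z ^ℚ suc b         <⟨ ^-mono-< b (0≤fromℕ Z) Z<s ⟩
  s ^ℚ suc b               ≤⟨ s^b≤n^a ⟩
  fromℕ (n ^ a)            ≤⟨ fromℕ-mono (≤-trans (^-monoˡ-≤ a n≤Z^d)
                                (≤-trans (≤-reflexive (^-*-assoc Z d a)) (^-monoʳ-≤ Z da≤b))) ⟩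
  fromℕ (Z ^ suc b)        ≡⟨ fromℕ-^ Z (suc b) ⟩
  fromℕ Z ^ℚ suc b         ∎)
  where open ℚ.≤-Reasoning

-- ½ is the rational witnessing 0 < log n in the definition of log.
log≥½ : ∀ n .{{_ : NonTrivial n}} {t} → ¬ Lower (real (log n)) t → ℚ.½ ℚ.≤ t
log≥½ n t∉ = ℚ.≮⇒≥ λ t<½ →
  let p , 0≤p , sums , _ = ℝ⁺.0< (log n) in t∉ (p , 0≤p , sums , t<½)

-- Here t is an upper bound of log n, so b/2 ≤ b t < 1.
1/log≤2 : ∀ n .{{_ : NonTrivial n}} {b} → 0ℚ ℚ.≤ b → Lower (real (log n ⁻¹)) b → b ℚ.≤ fromℕ 2
1/log≤2 n {b} 0≤b (t , t∉ , bt<1) = ℚ.*-cancelʳ-≤-pos ℚ.½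
  (ℚ.≤-trans (ℚ.*-monoˡ-≤-nonNeg b {{ℚ.nonNegative 0≤b}} (log≥½ n t∉)) (ℚ.<⇒≤ bt<1))

reciprocal : ∀ m .{{_ : NonZero m}} → ∃[ c ] (0ℚ ℚ.< c × c ℚ.* fromℕ m ≡ 1ℚ)
reciprocal m = ℚ.1/ fromℕ m , ℚ.positive⁻¹ (ℚ.1/ fromℕ m) {{ℚ.1/pos⇒pos (fromℕ m)}} , ℚ.*-inverseˡ (fromℕ m)
  where instance
    m-positive : ℚ.Positive (fromℕ m)
    m-positive = ℚ.normalize-pos m 1
    m-nonZero : ℚ.NonZero (fromℕ m)
    m-nonZero = ℚ.pos⇒nonZero (fromℕ m)

rescale : ∀ {c} K x → c ℚ.* fromℕ (32 * K) ≡ 1ℚ →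
  fromℕ 8 ℚ.* (c ℚ.* fromℕ (K * (2 * x)) ℚ.* fromℕ 2) ≡ fromℕ x
rescale {c} K x c-inverse = begin
  fromℕ 8 ℚ.* (c ℚ.* fromℕ Z ℚ.* fromℕ 2)      ≡⟨ ℚ.*-comm (fromℕ 8) (c ℚ.* fromℕ Z ℚ.* fromℕ 2) ⟩
  c ℚ.* fromℕ Z ℚ.* fromℕ 2 ℚ.* fromℕ 8        ≡⟨ ℚ.*-assoc (c ℚ.* fromℕ Z) (fromℕ 2) (fromℕ 8) ⟩
  c ℚ.* fromℕ Z ℚ.* fromℕ 16                   ≡⟨ ℚ.*-assoc c (fromℕ Z) (fromℕ 16) ⟩
  c ℚ.* (fromℕ Z ℚ.* fromℕ 16)                 ≡⟨ cong (c ℚ.*_) (fromℕ-* Z 16) ⟨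
  c ℚ.* fromℕ (Z * 16)                         ≡⟨ cong (λ m → c ℚ.* fromℕ m) (regroup K x) ⟩
  c ℚ.* fromℕ (32 * K * x)                     ≡⟨ cong (c ℚ.*_) (fromℕ-* (32 * K) x) ⟩
  c ℚ.* (fromℕ (32 * K) ℚ.* fromℕ x)           ≡⟨ ℚ.*-assoc c (fromℕ (32 * K)) (fromℕ x) ⟨
  c ℚ.* fromℕ (32 * K) ℚ.* fromℕ x             ≡⟨ cong (ℚ._* fromℕ x) c-inverse ⟩
  1ℚ ℚ.* fromℕ x                               ≡⟨ ℚ.*-identityˡ (fromℕ x) ⟩
  fromℕ x                                      ∎
  where
  open ≡-Reasoning
  Z = K * (2 * x)
  regroup : ∀ K x → K * (2 * x) * 16 ≡ 32 * K * x
  regroup = solve-∀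

-- A member of the lower cut of a product lies below a product of members of the factors' cuts.
-- These are at most c, Z and 2 for the three factors; the gap u below 1/(2(k+1)) controls the
-- exponent e.
product-bound : ∀ {c Z δ k n q} .{{_ : NonTrivial n}} .{{_ : NonZero Z}} (0<c : 0ℚ ℚ.< c) →
  n ≤ Z ^ (2 * suc k) → real δ <ℝ fromℚ (ℤ.+ 1 ℚ./ (2 * suc k)) →
  Lower (real (record { real = fromℚ c ; 0< = 0<c } · n ^ℝ δ ÷ log n)) q →
  q ℚ.< c ℚ.* fromℕ Z ℚ.* fromℕ 2
product-bound {c} {Z} {δ} {k} {n} {q} 0<c n≤Z^d (u , u<1/d , u∉δ)
  (a , b , 0<a , 0<b , (a₁ , a₂ , 0<a₁ , 0<a₂ , a₁<c , (e , s , e∈δ , 0≤e , _ , s^b≤n^a , a₂<s) , a<a₁a₂) , b∈ , q<ab) =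
  ℚ.<-≤-trans q<ab (*-mono-≤ {a} {c ℚ.* fromℕ Z} {b} {fromℕ 2} (ℚ.<⇒≤ 0<a) (0≤fromℕ 2) a≤cZ
    (1/log≤2 n {b} (ℚ.<⇒≤ 0<b) b∈))
  where
  e≤ : e ℚ.≤ ℤ.+ 1 ℚ./ (2 * suc k)
  e≤ = ℚ.<⇒≤ (ℚ.<-trans {e} {u} (ℝ.Lower<bound (real δ) {e} {u} e∈δ u∉δ) u<1/d)

  s≤Z : s ℚ.≤ fromℕ Z
  s≤Z = root-bound {n} {ℤ.∣ ℚ.↥ e ∣} {ℚ.denominator-1 e} {Z} {2 * suc k} {s} n≤Z^d
    (numerator-bound e (k + suc (k + 0)) 0≤e e≤) s^b≤n^a

  a≤cZ : a ℚ.≤ c ℚ.* fromℕ Z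
  a≤cZ = ℚ.≤-trans {a} {a₁ ℚ.* a₂} (ℚ.<⇒≤ a<a₁a₂)
    (*-mono-≤ {a₁} {c} {a₂} {fromℕ Z} (ℚ.<⇒≤ 0<a₁) (0≤fromℕ Z) (ℚ.<⇒≤ a₁<c)
      (ℚ.≤-trans {a₂} {s} (ℚ.<⇒≤ a₂<s) s≤Z))

-- The factor 32 · 10^k is the product of the losses in x ≤ 8 χᶠ, n ≤ (2 · 10^k · x)^(2(k+1))
-- and 1 / log n ≤ 2.
high-girth-graphs : ∀ k δ → real δ <ℝ fromℚ (ℤ.+ 1 ℚ./ (2 * suc k)) →
  Σ[ c ∈ ℝ⁺ ] ((n : ℕ) .{{_ : NonTrivial n}} → 10 ^ k ≤ n →
    ∃[ Y ] (HighGirth (2 + k) Y × real (c · n ^ℝ δ ÷ log n) ≤ℝ χᶠ {n} Y))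
high-girth-graphs k δ δ< = from-reciprocal (reciprocal (32 * 10 ^ k) {{m*n≢0 32 (10 ^ k) {{_}} {{m^n≢0 10 k}}}})
  where
  from-reciprocal : ∃[ c ] (0ℚ ℚ.< c × c ℚ.* fromℕ (32 * 10 ^ k) ≡ 1ℚ) →
    Σ[ c ∈ ℝ⁺ ] ((n : ℕ) .{{_ : NonTrivial n}} → 10 ^ k ≤ n →
      ∃[ Y ] (HighGirth (2 + k) Y × real (c · n ^ℝ δ ÷ log n) ≤ℝ χᶠ {n} Y))
  from-reciprocal (c , 0<c , c-inverse) = record { real = fromℚ c ; 0< = 0<c } , graphs
    where
    graphs : (n : ℕ) .{{_ : NonTrivial n}} → 10 ^ k ≤ n →
      ∃[ Y ] (HighGirth (2 + k) Y ×
        real (record { real = fromℚ c ; 0< = 0<c } · n ^ℝ δ ÷ log n) ≤ℝ χᶠ {n} Y)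
    graphs n 10^k≤n =
      let x , x≢0 , small , n≤Z^d = scale k n 10^k≤n
          Y , high-girth , x≤8total = large-girth-graph n x k {{nonTrivial⇒nonZero n}} {{x≢0}} small
          Z = 10 ^ k * (2 * x)
          Z≢0 = m*n≢0 (10 ^ k) (2 * x) {{m^n≢0 10 k}} {{m*n≢0 2 x {{_}} {{x≢0}}}}
      in Y , high-girth , λ {q} q∈ →
         -- The rational required by the cut of `χᶠ Y`: it lies above q and equals x/8 by `rescale`,
         -- hence is at most every total weight.
         c ℚ.* fromℕ Z ℚ.* fromℕ 2 , product-bound {c} {Z} {δ} {k} {n} {q} {{it}} {{Z≢0}} 0<c n≤Z^d δ< q∈ , λ col →
         ℚ.*-cancelˡ-≤-pos (fromℕ 8) (ℚ.≤-trans (ℚ.≤-reflexive (rescale {c} (10 ^ k) x c-inverse)) (x≤8total col))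

1/2[r-1]≡ : ∀ k (4≤2+k : 4 ≤ 2 + k) → 1/2[r-1] (2 + k) 4≤2+k ≡ ℤ.+ 1 ℚ./ (2 * suc k)
1/2[r-1]≡ k 4≤2+k = refl

proposition9p14 : (r : ℕ) (4≤r : 4 ≤ r) (δ : ℝ⁺) → real δ <ℝ fromℚ (1/2[r-1] r 4≤r) →
    (Σ[ c ∈ ℝ⁺ ] ∃[ N ] ((n : ℕ) .{{_ : NonTrivial n}} → N ≤ n →
    Σ[ Y ∈ Graph n ] Σ[ F ∈ EdgeSet n ] Σ[ F⊆E ∈ F ⊆E E Y ]
    (Y ⊆G K n
    × real (c · n ^ℝ δ ÷ log n) ≤ℝ χᶠ Y
    × Δ (spanning Y F F⊆E) ≤ 1
    × [ r ] ≤⁺ girth (Y ─ F))))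
    ×
    (Σ[ c ∈ ℝ⁺ ] ∃[ N ] ((n : ℕ) .{{_ : NonTrivial n}} → N ≤ n →
    real (c · n ^ℝ δ ÷ log n) ≤ℝ hᶠ r (K n)))
proposition9p14 zero          ()
proposition9p14 (suc zero)    (s≤s ())
proposition9p14 (suc (suc k)) 4≤r δ δ< =
    -- The threshold 10^k is where x = 1 becomes admissible in `scale`.
    (proj₁ G , 10 ^ k , λ n 10^k≤n →
      let Y , high-girth , large-χᶠ = proj₂ G n 10^k≤n
      in Y , ∅ , (λ ()) , ⊆K Y , large-χᶠ , Δ-∅ Y (λ ()) ,
         girth-bound {G = Y ─ ∅} (high-girth {Y ─ ∅} (proj₁ ∘ Equivalence.to T-∧)))
  , (proj₁ G , 10 ^ k , λ n 10^k≤n {q} q∈ →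
      let Y , high-girth , large-χᶠ = proj₂ G n 10^k≤n
      in Y , ⊆K Y , girth-bound {G = Y} (high-girth {Y} id) , large-χᶠ q∈)
  where
  G = high-girth-graphs k δ (subst (λ b → real δ <ℝ fromℚ b) (1/2[r-1]≡ k 4≤r) δ<)
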